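{- Let $c>1$ be a constant. For every constant $\epsilon>0$ there is a constant $\gamma>0$ and a data structure for OV indexing on $n$ input vectors of length $c\log n$ with query time $O(n^{\epsilon})$ and space $O(n^{c-\gamma})$.
   Context: Orthogonal Vectors Indexing (OV indexing): given a set $S$ of $n$ boolean vectors of length $d$, preprocess $S$ into a data structure that answers queries of the form: given $v\in\{0,1\}^d$, is there a vector in $S$ orthogonal to $v$? Vectors $u,v\in\{0,1\}^d$ are orthogonal if there is no coordinate $i$ with $u_i=v_i=1$. Here $d=c\log n$ for a constant $c>1$; $\log$ is base 2 and $c\log n$ is rounded to an integer. The model is the standard word RAM with words of $\Theta(\log n)$ bits; space is the size of the data structure produced by preprocessing. Constants hidden in $O(\cdot)$ may depend on $c$ and $\epsilon$. -}

module Defs where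

open import Data.Bool using (Bool; true; false; if_then_else_; _∧_; _∨_; _xor_)
open import Data.Fin using (Fin; toℕ)
import Data.Fin as Fin
import Data.Integer as ℤ
open import Data.List using (List; []; _∷_; length; _++_)
import Data.List as List
open import Data.Maybe using (Maybe; just; nothing; fromMaybe)
open import Data.Nat
  using (ℕ; zero; suc; _+_; _*_; _∸_; _^_; _≤_; _<_; _≥_; _≡ᵇ_; _<ᵇ_; _≟_; ⌊_/2⌋)
open import Data.Nat.DivMod using (_/_; _%_; _mod_)
open import Data.Nat.Logarithm using (⌈log₂_⌉)
open import Data.Nat.Properties using (m^n≢0)
open import Data.Product using (∃-syntax; _×_; _,_)
open import Data.Rational using (ℚ; 0ℚ; 1ℚ; ½; ↥_; ↧ₙ_)
import Data.Rational as ℚ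
import Data.Rational.Properties as ℚP
open import Data.Rational.Solver using (module +-*-Solver)
open import Data.Vec using (Vec; lookup; toList)
open import Data.Vec.Membership.Propositional using (_∈_)
open import Data.Vec.Relation.Unary.Unique.Propositional using (Unique)
open import Function using (_⇔_)
open import Relation.Binary.Definitions using (DecidableEquality)
open import Relation.Binary.PropositionalEquality using (_≡_; refl; subst; subst₂)
open import Relation.Nullary using (¬_; does)

-- Real numbers as two-sided Dedekind cuts
record ℝ : Set₁ where
  field
    Lower Upper  : ℚ → Set
    lower-closed : ∀ {p q} → p ℚ.< q → Lower q → Lower p
    lower-open   : ∀ {p} → Lower p → ∃[ q ] p ℚ.< q × Lower q
    upper-closed : ∀ {p q} → p ℚ.< q → Upper p → Upper q
    upper-open   : ∀ {q} → Upper q → ∃[ p ] p ℚ.< q × Upper p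
    disjoint     : ∀ {p q} → Lower p → Upper q → p ℚ.< q
    located      : ∀ {δ} → 0ℚ ℚ.< δ →
                   ∃[ p ] ∃[ q ] Lower p × Upper q × q ℚ.< p ℚ.+ δ

open ℝ public

infix 4 _<ʳ_
infixl 6 _-ʳ_

_<ʳ_ : ℝ → ℝ → Set
x <ʳ y = ∃[ q ] Upper x q × Lower y q

private
  <-shift : ∀ p {δ} → 0ℚ ℚ.< δ → p ℚ.< p ℚ.+ δ
  <-shift p {δ} 0<δ = subst (ℚ._< p ℚ.+ δ) (ℚP.+-identityʳ p) (ℚP.+-monoʳ-< p 0<δ)

  <-unshift : ∀ p {δ} → 0ℚ ℚ.< δ → p ℚ.- δ ℚ.< p
  <-unshift p {δ} 0<δ = subst (p ℚ.- δ ℚ.<_)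
    (solve 2 (λ p δ → p :- δ :+ δ := p) refl p δ) (<-shift (p ℚ.- δ) 0<δ)
    where open +-*-Solver

  +-cancelʳ-< : ∀ r {p q} → p ℚ.+ r ℚ.< q ℚ.+ r → p ℚ.< q
  +-cancelʳ-< r {p} {q} h = subst₂ ℚ._<_ (lem p r) (lem q r) (ℚP.+-monoˡ-< (ℚ.- r) h)
    where
    open +-*-Solver
    lem : ∀ p r → p ℚ.+ r ℚ.+ ℚ.- r ≡ p
    lem = solve 2 (λ p r → p :+ r :+ :- r := p) refl

  quarter : ℚ → ℚ
  quarter δ = ½ ℚ.* ½ ℚ.* δ

  quarter-pos : ∀ {δ} → 0ℚ ℚ.< δ → 0ℚ ℚ.< quarter δ
  quarter-pos {δ} 0<δ =
    subst (ℚ._< quarter δ) (ℚP.*-zeroʳ (½ ℚ.* ½)) (ℚP.*-monoʳ-<-pos (½ ℚ.* ½) 0<δ)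

fromℚ : ℚ → ℝ
fromℚ r = record
  { Lower        = ℚ._< r
  ; Upper        = r ℚ.<_
  ; lower-closed = ℚP.<-trans
  ; lower-open   = ℚP.<-dense
  ; upper-closed = λ p<q r<p → ℚP.<-trans r<p p<q
  ; upper-open   = λ r<q → let (p , r<p , p<q) = ℚP.<-dense r<q in p , p<q , r<p
  ; disjoint     = ℚP.<-trans
  ; located      = λ {δ} 0<δ → let 0<η = quarter-pos 0<δ ; η = quarter δ in
      r ℚ.- η , r ℚ.+ η , <-unshift r 0<η , <-shift r 0<η ,
      subst (r ℚ.+ η ℚ.<_)
        (solve 2 (λ r δ → let η = con (½ ℚ.* ½) :* δ in
            r :+ η :+ (η :+ η) := r :- η :+ δ) refl r δ)
        (<-shift (r ℚ.+ η) (ℚP.+-mono-< 0<η 0<η))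
  }
  where open +-*-Solver

0ʳ 1ʳ : ℝ
0ʳ = fromℚ 0ℚ
1ʳ = fromℚ 1ℚ

_-ʳ_ : ℝ → ℝ → ℝ
x -ʳ y = record
  { Lower        = λ q → ∃[ a ] ∃[ b ] Lower x a × Upper y b × q ℚ.+ b ℚ.< a
  ; Upper        = λ q → ∃[ a ] ∃[ b ] Upper x a × Lower y b × a ℚ.< q ℚ.+ b
  ; lower-closed = λ p<q (a , b , la , ub , h) →
      a , b , la , ub , ℚP.<-trans (ℚP.+-monoˡ-< b p<q) h
  ; lower-open   = λ {q} (a , b , la , ub , h) →
      let (m , h₁ , h₂) = ℚP.<-dense h in
      m ℚ.- b , +-cancelʳ-< b (subst (q ℚ.+ b ℚ.<_) (cancel m b) h₁) ,
      a , b , la , ub , subst (ℚ._< a) (cancel m b) h₂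
  ; upper-closed = λ p<q (a , b , ua , lb , h) →
      a , b , ua , lb , ℚP.<-trans h (ℚP.+-monoˡ-< b p<q)
  ; upper-open   = λ {q} (a , b , ua , lb , h) →
      let (m , h₁ , h₂) = ℚP.<-dense h in
      m ℚ.- b , +-cancelʳ-< b (subst (ℚ._< q ℚ.+ b) (cancel m b) h₂) ,
      a , b , ua , lb , subst (a ℚ.<_) (cancel m b) h₁
  ; disjoint     = λ {p} {q} (a , b , la , ub , h) (a′ , b′ , ua′ , lb′ , h′) →
      +-cancelʳ-< b (ℚP.<-trans h (ℚP.<-trans (disjoint x la ua′)
        (ℚP.<-trans h′ (ℚP.+-monoʳ-< q (disjoint y lb′ ub)))))
  ; located      = λ {δ} 0<δ →
      let η = quarter δ
          0<η = quarter-pos 0<δ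
          (p , q , lp , uq , q<p+η) = located x 0<η
          (r , s , lr , us , s<r+η) = located y 0<η
      in p ℚ.- s ℚ.- η , q ℚ.- r ℚ.+ η ,
         (p , s , lp , us ,
           subst (ℚ._< p) (solve 3 (λ p s η → p :- η := p :- s :- η :+ s) refl p s η)
             (<-unshift p 0<η)) ,
         (q , r , uq , lr ,
           subst (q ℚ.<_) (solve 3 (λ q r η → q :+ η := q :- r :+ η :+ r) refl q r η)
             (<-shift q 0<η)) ,
         subst₂ ℚ._<_
           (solve 4 (λ q r s δ → let η = con (½ ℚ.* ½) :* δ in
              q :+ s :+ (:- r :- s :+ η) := q :- r :+ η) refl q r s δ)
           (solve 4 (λ p r s δ → let η = con (½ ℚ.* ½) :* δ in
              p :+ η :+ (r :+ η) :+ (:- r :- s :+ η) := p :- s :- η :+ δ) refl p r s δ)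
           (ℚP.+-monoˡ-< (ℚ.- r ℚ.- s ℚ.+ η) (ℚP.+-mono-< q<p+η s<r+η))
  }
  where
  open +-*-Solver
  cancel : ∀ m b → m ≡ m ℚ.- b ℚ.+ b
  cancel = solve 2 (λ m b → m := m :- b :+ b) refl

-- For n ≥ 1 and q = a/b the power n^q is the positive number with
-- (n^q)^b = n^a = n^(max a 0) / n^(max (-a) 0), so m is compared with
-- C · n^q by raising both sides to the b-th power and clearing
-- denominators.  Real powers are then determined by monotonicity and
-- continuity of q ↦ n^q.

posPart negPart : ℤ.ℤ → ℕ
posPart (ℤ.+ a)    = a
posPart ℤ.-[1+ a ] = 0
negPart (ℤ.+ a)    = 0
negPart ℤ.-[1+ a ] = suc a

numPow denPow : ℕ → ℚ → ℕ
numPow n q = n ^ posPart (↥ q)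
denPow n q = n ^ negPart (↥ q)

infix 4 _≤[_·_^_] _<[_·_^_] [_^_]<_

_≤[_·_^_] : ℕ → ℕ → ℕ → ℝ → Set
m ≤[ C · n ^ x ] =
  ∀ q → Upper x q → m ^ ↧ₙ q * denPow n q ≤ C ^ ↧ₙ q * numPow n q

_<[_·_^_] : ℕ → ℕ → ℕ → ℝ → Set
m <[ C · n ^ x ] =
  ∃[ q ] Lower x q × m ^ ↧ₙ q * denPow n q < C ^ ↧ₙ q * numPow n q

[_^_]<_ : ℕ → ℝ → ℕ → Set
[ n ^ x ]< m =
  ∃[ q ] Upper x q × numPow n q < m ^ ↧ₙ q * denPow n q

-- d is c · log₂ n rounded (up or down) to an integer, that is,
-- d - 1 < c · log₂ n < d + 1, exponentiated with base 2.
_RoundsLog[_,_] : ℕ → ℝ → ℕ → Set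
d RoundsLog[ c , n ] = (2 ^ d <[ 2 · n ^ c ]) × ([ n ^ c ]< (2 ^ suc d))

IsΘlog : (ℕ → ℕ) → Set
IsΘlog f = ∃[ A ] ∃[ n₀ ] ∀ n → n ≥ n₀ →
  ⌈log₂ n ⌉ ≤ A * f n × f n ≤ A * ⌈log₂ n ⌉

Word : ℕ → Set
Word w = Fin (2 ^ w)

trunc : ∀ w → ℕ → Word w
trunc w x = _mod_ x (2 ^ w) {{m^n≢0 2 w}}

data Op : Set where
  ADD SUB MUL DIV MOD AND OR XOR SHL SHR EQ LT : Op

bit : Bool → ℕ
bit b = if b then 1 else 0

bitwise : (Bool → Bool → Bool) → ℕ → ℕ → ℕ → ℕ
bitwise f zero    x y = 0
bitwise f (suc k) x y =
  bit (f (x % 2 ≡ᵇ 1) (y % 2 ≡ᵇ 1)) + 2 * bitwise f k ⌊ x /2⌋ ⌊ y /2⌋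

-- Operations act on words as natural numbers below 2 ^ w; division and
-- remainder by zero return zero.
opℕ : ℕ → Op → ℕ → ℕ → ℕ
opℕ w ADD x y       = x + y
opℕ w SUB x y       = (x + 2 ^ w) ∸ y
opℕ w MUL x y       = x * y
opℕ w DIV x zero    = 0
opℕ w DIV x (suc y) = x / suc y
opℕ w MOD x zero    = 0
opℕ w MOD x (suc y) = x % suc y
opℕ w AND x y       = bitwise _∧_ w x y
opℕ w OR  x y       = bitwise _∨_ w x y
opℕ w XOR x y       = bitwise _xor_ w x y
opℕ w SHL x y       = x * 2 ^ y
opℕ w SHR x y       = _/_ x (2 ^ y) {{m^n≢0 2 y}}
opℕ w EQ  x y       = bit (x ≡ᵇ y)
opℕ w LT  x y       = bit (x <ᵇ y)

evalOp : ∀ w → Op → Word w → Word w → Word w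
evalOp w o x y = trunc w (opℕ w o (toℕ x) (toℕ y))

-- A program is finite, so it uses only finitely many registers.
Reg : Set
Reg = ℕ

data Instr : Set where
  loadi : Reg → ℕ → Instr              -- r ← k
  op    : Op → Reg → Reg → Reg → Instr -- r ← s ∘ t
  load  : Reg → Reg → Instr            -- r ← M[s]
  store : Reg → Reg → Instr            -- M[r] ← s
  jump  : ℕ → Instr
  jzero : Reg → ℕ → Instr              -- jump if r = 0
  halt  : Bool → Instr                 -- stop and answer yes or no

Program : Set
Program = List Instr

record Config (w : ℕ) : Set where
  constructor config
  field
    pc   : ℕ
    regs : Reg → Word w
    mem  : Word w → Word w

update : {A B : Set} → DecidableEquality A → (A → B) → A → B → A → B
update _≟ᴬ_ f k x j = if does (j ≟ᴬ k) then x else f j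

exec : ∀ {w} → Instr → Config w → Config w
exec {w} (loadi r k)   (config pc R M) = config (suc pc) (update _≟_ R r (trunc w k)) M
exec {w} (op o r s t)  (config pc R M) = config (suc pc) (update _≟_ R r (evalOp w o (R s) (R t))) M
exec (load r s)        (config pc R M) = config (suc pc) (update _≟_ R r (M (R s))) M
exec (store r s)       (config pc R M) = config (suc pc) R (update Fin._≟_ M (R r) (R s))
exec (jump l)          (config pc R M) = config l R M
exec (jzero r l)       (config pc R M) = config (if toℕ (R r) ≡ᵇ 0 then l else suc pc) R M
exec (halt b)          σ               = σ

infixl 5 _!?_

_!?_ : {A : Set} → List A → ℕ → Maybe A
[]       !? i     = nothing
(x ∷ xs) !? zero  = just x
(x ∷ xs) !? suc i = xs !? i

-- The answer given within a number of steps, if any; a program counter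
-- outside the program never gives one.
run : ∀ {w} → Program → ℕ → Config w → Maybe Bool
run P zero    σ = nothing
run P (suc t) σ with P !? Config.pc σ
... | nothing       = nothing
... | just (halt b) = just b
... | just i        = run P t (exec i σ)

-- Memory holds the data structure from address 0 on, followed by the
-- query vector with one coordinate per word, and zeros elsewhere.
-- Register 0 holds the address of the query vector.
initial : ∀ w {d} → List (Word w) → Vec Bool d → Config w
initial w D v = config 0
  (update _≟_ (λ _ → trunc w 0) 0 (trunc w (length D)))
  (λ a → fromMaybe (trunc w 0) (contents !? toℕ a))
  where contents = D ++ List.map (λ b → trunc w (bit b)) (toList v)

Orthogonal : ∀ {d} → Vec Bool d → Vec Bool d → Set
Orthogonal u v = ¬ (∃[ i ] lookup u i ≡ true × lookup v i ≡ true)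

HasOrthogonal : ∀ {n d} → Vec (Vec Bool d) n → Vec Bool d → Set
HasOrthogonal S v = ∃[ u ] u ∈ S × Orthogonal u v

-- Data structures for vectors of length c log n.  The query program is
-- the same for all n; preprocessing is any function of the input set.
record OVIndex (c : ℝ) : Set where
  field
    wordSize   : ℕ → ℕ
    wordSize-Θ : IsΘlog wordSize
    preprocess : ∀ {n d} → Vec (Vec Bool d) n → List (Word (wordSize n))
    query      : Program

  answer : ∀ {n d} → Vec (Vec Bool d) n → Vec Bool d → ℕ → Maybe Bool
  answer {n} S v t = run query t (initial (wordSize n) (preprocess S) v)

  field
    correct : ∀ {n d} → 1 ≤ n → d RoundsLog[ c , n ] →
              (S : Vec (Vec Bool d) n) → Unique S → (v : Vec Bool d) →
              ∃[ t ] ∃[ b ] answer S v t ≡ just b × (b ≡ true ⇔ HasOrthogonal S v)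

open OVIndex public

QueryTimeO : ∀ {c} → OVIndex c → ℝ → Set
QueryTimeO {c} I x = ∃[ C ] ∃[ n₀ ] ∀ {n d} → n ≥ n₀ → 1 ≤ n → d RoundsLog[ c , n ] →
  (S : Vec (Vec Bool d) n) → Unique S → (v : Vec Bool d) →
  ∃[ t ] ∃[ b ] answer I S v t ≡ just b × t ≤[ C · n ^ x ]

-- Space is counted in words.
SpaceO : ∀ {c} → OVIndex c → ℝ → Set
SpaceO {c} I x = ∃[ C ] ∃[ n₀ ] ∀ {n d} → n ≥ n₀ → 1 ≤ n → d RoundsLog[ c , n ] →
  (S : Vec (Vec Bool d) n) → Unique S →
  length (preprocess I S) ≤[ C · n ^ x ]

{-# OPTIONS --safe #-}
-- Adding coordinates to a query can only destroy orthogonality.  Fix a large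
-- constant k and let m = d / 2k.  All positive queries with at least (k + 1) m
-- ones or at least (k + 1) m zeros are stored; they are exponentially sparse in
-- the cube.  A remaining query v orthogonal to u either differs from the
-- complement of u in at most 2m places, or can be raised by 2m ones inside
-- that complement and then has (k + 1) m ones.  The queries of the first kind
-- number at most n times the number of vectors of weight at most 2m, which is
-- n^(1 + o(1)) as k grows, and are stored as well.  Hence v is positive iff
-- v ∪ F is stored for some F of weight at most 2m.  The stored queries form a
-- trie, and the sets F a tape along which the program walks through the trie.
module Submission where

open import Defs
open import Data.Bool using (Bool; true; false; if_then_else_; _∨_; not)
import Data.Bool as Bool
open import Data.Empty using (⊥-elim)
import Data.Fin as Fin
open import Data.Fin using (toℕ)
import Data.Fin.Properties as FinP
import Data.Integer as ℤ
import Data.Integer.Properties as ℤP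
import Data.Integer.Tactic.RingSolver as ℤSolver
open import Data.List using (List; []; _∷_; length; _++_; filter; concatMap)
import Data.List as List
open import Data.List.Membership.Propositional using () renaming (_∈_ to _∈ˡ_; find to findˡ; lose to loseˡ)
open import Data.List.Membership.Propositional.Properties
  using (∈-map⁺; ∈-map⁻; ∈-++⁺ˡ; ∈-++⁺ʳ; ∈-++⁻; ∈-filter⁺; ∈-filter⁻; ∈-concatMap⁺; ∈-concatMap⁻)
open import Data.List.Properties
  using (length-++; length-map; length-filter; map-++; ++-assoc; map-∘; map-cong)
open import Data.List.Relation.Unary.All using (All; []; _∷_)
import Data.List.Relation.Unary.All.Properties as AllP
open import Data.List.Relation.Unary.Any using (Any; here; there)
open import Data.Maybe using (just; fromMaybe)
open import Data.Nat
open import Data.Nat.Coprimality using (1-coprimeTo)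
open import Data.Nat.DivMod using (_/_; _%_; m<n⇒m%n≡m; m%n<n; m≡m%n+[m/n]*n)
open import Data.Nat.Induction using (<-rec)
open import Data.Nat.ListAction using (sum)
open import Data.Nat.ListAction.Properties using (sum-++)
open import Data.Nat.Logarithm using (⌈log₂_⌉; ⌈log₂⌉-mono-≤; ⌈log₂⌈n/2⌉⌉≡⌈log₂n⌉∸1)
open import Data.Nat.Properties
open import Data.Nat.Tactic.RingSolver using (solve-∀)
open import Data.Product using (∃-syntax; Σ-syntax; _×_; _,_; proj₁; proj₂)
open import Data.Rational using (ℚ; mkℚ; 0ℚ; 1ℚ; ↥_; ↧_; ↧ₙ_; toℚᵘ)
import Data.Rational as ℚ
import Data.Rational.Properties as ℚP
import Data.Rational.Unnormalised.Properties as ℚᵘP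
open import Data.Sum using (_⊎_; inj₁; inj₂)
open import Data.Unit using (⊤; tt)
open import Data.Vec using (Vec; []; _∷_; lookup; toList)
import Data.Vec as Vec
open import Data.Vec.Membership.Propositional using (_∈_; find; lose)
open import Data.Vec.Membership.Propositional.Properties using (∈-toList⁺; ∈-toList⁻)
open import Data.Vec.Properties using (length-toList)
import Data.Vec.Relation.Unary.Any as VecAny
open import Function using (_⇔_; mk⇔)
open import Function.Construct.Composition using (_⇔-∘_)
open import Relation.Binary.PropositionalEquality hiding (J)
open import Relation.Nullary using (¬_; Dec; yes; no; contradiction)
open import Relation.Nullary.Decidable using (map′; ¬?; _×-dec_)

-- Memory and the query program

-- Up to constants 2^d is n^c, so lengths are compared with 2^d: a list of length A is short enough
-- if A^R · 2^d ≤ C · 2^(dR), a saving of 2^(d/R). The heavy and light layers save for every k,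
-- though the R obtained grows quickly with k. The near queries number about n · 2^(d/j) for k of
-- order j², and they save only because c > 1 puts n below 2^d by a fixed power. The same 2^(d/j)
-- governs the query time. So j is chosen first, from c and ε, and γ is read off at the end. Light
-- queries have to be stored too, because 2m additional ones need not lift them to a stored layer.
-- The program is one list of instructions for all n and d, so everything that depends on d sits in
-- the data: the tape names the cell to read next, and a mismatch in the trie does not cut a block
-- of the tape short but counts down through dead states, so that every F consumes equally many
-- cells. All estimates stay in the natural numbers: weighted sums over the cube replace binomial
-- coefficients, and Bernoulli's inequality replaces the entropy function.

toℕ-trunc : ∀ w {x} → x < 2 ^ w → toℕ (trunc w x) ≡ x
toℕ-trunc w {x} x< =
  trans (FinP.toℕ-fromℕ< (m%n<n x (2 ^ w) {{m^n≢0 2 w}})) (m<n⇒m%n≡m {{m^n≢0 2 w}} x<)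


-- Register 1 holds the constant 1, register 2 a position on the tape and
-- register 3 a state q; a tape cell holding the address x ≠ 0 is processed
-- by q ← M[q + M[x]], and a tape cell holding 0 ends the computation.
walker : Program
walker =
  loadi 1 1 ∷ loadi 2 3 ∷ load 2 2 ∷ loadi 3 4 ∷
  load 4 2 ∷ jzero 4 11 ∷ load 4 4 ∷ op ADD 3 3 4 ∷ load 3 3 ∷ op ADD 2 2 1 ∷ jump 4 ∷
  jzero 3 13 ∷ halt false ∷ halt true ∷ []

module Memory (w : ℕ) (M : Word w → Word w) where


  -- Addresses are natural numbers and the word `α` is quantified, so that no proof of `a < 2 ^ w`
  -- has to be carried along; outside the memory the statement is vacuous.
  Holds : ℕ → ℕ → Set
  Holds a x = ∀ α → toℕ α ≡ a → toℕ (M α) ≡ x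

  Segment : ℕ → List ℕ → Set
  Segment a []       = ⊤
  Segment a (x ∷ xs) = Holds a x × Segment (suc a) xs

  Segment-++ : ∀ a xs {ys} → Segment a (xs ++ ys) →
               Segment a xs × Segment (a + length xs) ys
  Segment-++ a [] {ys} seg = tt , subst (λ b → Segment b ys) (sym (+-identityʳ a)) seg
  Segment-++ a (x ∷ xs) {ys} (h , seg) with Segment-++ (suc a) xs seg
  ... | l , r = (h , l) , subst (λ b → Segment b ys) (sym (+-suc a (length xs))) r


  -- One `step` is one round of the program's loop. `x ≢ 0` keeps the end test from firing, and
  -- `q + b < 2 ^ w` keeps `ADD` from wrapping around.
  data Walk : List ℕ → ℕ → ℕ → Set where
    stop : ∀ {q} → Walk [] q q
    step : ∀ {x xs q q′ q″} b → x ≢ 0 → Holds x b → q + b < 2 ^ w → Holds (q + b) q′ →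
           Walk xs q′ q″ → Walk (x ∷ xs) q q″

  Walk-++ : ∀ {xs ys q q′ q″} →
            Walk xs q q′ → Walk ys q′ q″ → Walk (xs ++ ys) q q″
  Walk-++ stop                    u = u
  Walk-++ (step b x≢0 hx hb hq t) u = step b x≢0 hx hb hq (Walk-++ t u)

  ≡ᵇ-zero : ∀ {x} → x ≢ 0 → (x ≡ᵇ 0) ≡ false
  ≡ᵇ-zero {zero}  h = ⊥-elim (h refl)
  ≡ᵇ-zero {suc x} h = refl

  -- A nonzero cell costs the seven instructions at 4 and 6 to 10 together with the test at 5. The
  -- final zero costs four: load, test, the test of the state, and `halt`.
  walker-loop : ∀ xs {p q q′} (R : Reg → Word w) →
    Segment p (xs ++ 0 ∷ []) → p + length xs < 2 ^ w → Walk xs q q′ →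
    toℕ (R 1) ≡ 1 → toℕ (R 2) ≡ p → toℕ (R 3) ≡ q →
    run walker (4 + 7 * length xs) (config {w} 4 R M) ≡ just (q′ ≡ᵇ 0)
  walker-loop [] {q = q} R (end , _) p< stop r₁ r₂ r₃
    rewrite end (R 2) r₂ | r₃ = final q
    where
    final : ∀ q {R′} → run walker 1 (config {w} (if q ≡ᵇ 0 then 13 else 12) R′ M) ≡ just (q ≡ᵇ 0)
    final zero    = refl
    final (suc q) = refl
  walker-loop (x ∷ xs) {p} {q} {q′} R (cell , seg) p< (step b x≢0 hx qb< hq walk) r₁ r₂ r₃
    rewrite *-suc 7 (length xs) | cell (R 2) r₂ | ≡ᵇ-zero x≢0
    = walker-loop xs _ seg
        (subst (_< 2 ^ w) (+-suc p (length xs)) p<) walk r₁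
        (trans (cong (λ z → toℕ (trunc w z)) (trans (cong₂ _+_ r₂ r₁) (+-comm p 1)))
               (toℕ-trunc w (≤-<-trans (s≤s (m≤m+n p (length xs)))
                            (subst (_< 2 ^ w) (+-suc p (length xs)) p<))))
        (hq _ (trans (cong (λ z → toℕ (trunc w z)) (cong₂ _+_ r₃ (hx _ (cell (R 2) r₂))))
                     (toℕ-trunc w qb<)))

  walker-run : ∀ {R : Reg → Word w} xs {p q′} → 4 < 2 ^ w →
    Holds 3 p → Segment p (xs ++ 0 ∷ []) → p + length xs < 2 ^ w → Walk xs 4 q′ →
    run walker (8 + 7 * length xs) (config {w} 0 R M) ≡ just (q′ ≡ᵇ 0)
  walker-run xs 4< h₃ seg p< walk =
    walker-loop xs _ seg p< walk
      (toℕ-trunc w (≤-<-trans (s≤s z≤n) 4<))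
      (h₃ _ (toℕ-trunc w (≤-<-trans (s≤s (s≤s (s≤s z≤n))) 4<)))
      (toℕ-trunc w 4<)

tapeMemory : ∀ w → List ℕ → Word w → Word w
tapeMemory w C α = fromMaybe (trunc w 0) (List.map (trunc w) C !? toℕ α)

!?-drop : ∀ {A : Set} (xs ys : List A) i → (xs ++ ys) !? (length xs + i) ≡ ys !? i
!?-drop []       ys i = refl
!?-drop (x ∷ xs) ys i = !?-drop xs ys i

tapeMemory-Segment : ∀ w C → All (_< 2 ^ w) C → Memory.Segment w (tapeMemory w C) 0 C
tapeMemory-Segment w C bound = go [] C refl bound
  where
  go : ∀ pre xs → pre ++ xs ≡ C → All (_< 2 ^ w) xs → Memory.Segment w (tapeMemory w C) (length pre) xs
  go pre []       eq []           = tt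
  go pre (x ∷ xs) eq (x< ∷ bound) =
    (λ α α≡ → trans (cong toℕ (cell α α≡)) (toℕ-trunc w x<)) ,
    subst (λ a → Memory.Segment w (tapeMemory w C) a xs)
      (trans (length-++ pre) (+-comm (length pre) 1))
      (go (pre ++ x ∷ []) xs (trans (++-assoc pre (x ∷ []) xs) eq) bound)
    where
    cell : ∀ α → toℕ α ≡ length pre → tapeMemory w C α ≡ trunc w x
    cell α α≡ rewrite α≡ | sym eq | map-++ (trunc w) pre (x ∷ xs) =
      cong (fromMaybe (trunc w 0))
        (trans (cong ((List.map (trunc w) pre ++ List.map (trunc w) (x ∷ xs)) !?_)
                 (sym (trans (+-identityʳ _) (length-map (trunc w) pre))))
               (!?-drop (List.map (trunc w) pre) _ 0))


-- The data structure

tails : ∀ {d} → Bool → List (Vec Bool (suc d)) → List (Vec Bool d)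
tails c     []                = []
tails false ((false ∷ v) ∷ T) = v ∷ tails false T
tails false ((true  ∷ v) ∷ T) = tails false T
tails true  ((false ∷ v) ∷ T) = tails true T
tails true  ((true  ∷ v) ∷ T) = v ∷ tails true T

∈-tails⁺ : ∀ {d} c {v : Vec Bool d} T → (c ∷ v) ∈ˡ T → v ∈ˡ tails c T
∈-tails⁺ false ((false ∷ v) ∷ T) (here refl) = here refl
∈-tails⁺ true  ((true  ∷ v) ∷ T) (here refl) = here refl
∈-tails⁺ false ((false ∷ v) ∷ T) (there i)   = there (∈-tails⁺ false T i)
∈-tails⁺ false ((true  ∷ v) ∷ T) (there i)   = ∈-tails⁺ false T i
∈-tails⁺ true  ((false ∷ v) ∷ T) (there i)   = ∈-tails⁺ true T i
∈-tails⁺ true  ((true  ∷ v) ∷ T) (there i)   = there (∈-tails⁺ true T i)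

∈-tails⁻ : ∀ {d} c {v : Vec Bool d} T → v ∈ˡ tails c T → (c ∷ v) ∈ˡ T
∈-tails⁻ false ((false ∷ v) ∷ T) (here refl) = here refl
∈-tails⁻ true  ((true  ∷ v) ∷ T) (here refl) = here refl
∈-tails⁻ false ((false ∷ v) ∷ T) (there i)   = there (∈-tails⁻ false T i)
∈-tails⁻ false ((true  ∷ v) ∷ T) i           = there (∈-tails⁻ false T i)
∈-tails⁻ true  ((false ∷ v) ∷ T) i           = there (∈-tails⁻ true T i)
∈-tails⁻ true  ((true  ∷ v) ∷ T) (there i)   = there (∈-tails⁻ true T i)

length-tails : ∀ {d} (T : List (Vec Bool (suc d))) →
               length (tails false T) + length (tails true T) ≡ length T
length-tails []                = refl
length-tails ((false ∷ v) ∷ T) = cong suc (length-tails T)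
length-tails ((true  ∷ v) ∷ T) = trans (+-suc _ _) (cong suc (length-tails T))

-- A state of the walk is an address; the two cells from there on hold the
-- next states.  State 0 accepts and is absorbing, state 4 is the root, and
-- dead i leads back to the root in i steps.
dead : ℕ → ℕ
dead zero    = 4
dead (suc i) = suc (suc (dead i))

deadChain : ℕ → ℕ → List ℕ
deadChain i zero    = []
deadChain i (suc n) = dead i ∷ dead i ∷ deadChain (suc i) n

-- `d` is the number of bits still to be read. If no stored vector continues the prefix, exactly `d`
-- dead steps remain; if all bits are read and a vector is left, the state accepts.
trieState : ∀ d → ℕ → List (Vec Bool d) → ℕ
trieState d       a []      = dead d
trieState zero    a (_ ∷ _) = 0
trieState (suc d) a (_ ∷ _) = a

-- Empty subtrees occupy no cells, because `dead d` stands for them; this keeps the trie linear in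
-- the number of stored vectors, up to the factor `d`.
trie : ∀ d → ℕ → List (Vec Bool d) → List ℕ
trieNode : ∀ d → ℕ → List (Vec Bool (suc d)) → List ℕ

trie d       a []        = []
trie zero    a (_ ∷ _)   = []
trie (suc d) a T@(_ ∷ _) = trieNode d a T

trieNode d a T = trieState d a₀ (tails false T) ∷ trieState d a₁ (tails true T) ∷
                 trie d a₀ (tails false T) ++ trie d a₁ (tails true T)
  where
  a₀ = suc (suc a)
  a₁ = a₀ + length (trie d a₀ (tails false T))

-- The bits of F ∪ v, for v stored from address a on, are found at these
-- addresses; address 2 holds the constant 1.
bitAddresses : ∀ {d} → ℕ → Vec Bool d → List ℕ
bitAddresses a []          = []
bitAddresses a (true  ∷ F) = 2 ∷ bitAddresses (suc a) F
bitAddresses a (false ∷ F) = a ∷ bitAddresses (suc a) F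

-- The leading 2 reads a bit 1: it takes state 4 through cell 5 into the trie and leaves state 0 at
-- 0 through cell 1. Each block thus restarts the search unless an earlier one has succeeded.
tape : ∀ {d} → ℕ → List (Vec Bool d) → List ℕ
tape a []       = []
tape a (F ∷ Fs) = 2 ∷ bitAddresses a F ++ tape a Fs

-- The query vector is placed after the structure, at `size`, so the tape contains an address that
-- depends on the total length. This is not circular: the length of the tape does not depend on the
-- base address. The dead chain starts at `dead 1`, which is 6, and therefore ends at
-- `dead (suc d)`.
module Layout {d} (T Fs : List (Vec Bool d)) where
  trieStart tapeStart size : ℕ
  trieStart = dead (suc d)
  tapeStart = trieStart + length (trie d trieStart T)
  size      = tapeStart + (length Fs * suc d + 1)

  root : ℕ
  root = trieState d trieStart T

  structure : List ℕ
  structure = 0 ∷ 0 ∷ 1 ∷ tapeStart ∷ root ∷ root ∷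
              deadChain 0 d ++ trie d trieStart T ++ tape size Fs ++ 0 ∷ []

_∪_ : ∀ {d} → Vec Bool d → Vec Bool d → Vec Bool d
_∪_ = Vec.zipWith _∨_

infixr 6 _∪_

-- Lengths and address bounds of the layout

length-deadChain : ∀ i n → dead i + length (deadChain i n) ≡ dead (i + n)
length-deadChain i zero    = trans (+-identityʳ _) (cong dead (sym (+-identityʳ i)))
length-deadChain i (suc n) = begin
  dead i + suc (suc (length (deadChain (suc i) n)))  ≡⟨ +-suc (dead i) _ ⟩
  suc (dead i + suc (length (deadChain (suc i) n)))  ≡⟨ cong suc (+-suc (dead i) _) ⟩
  dead (suc i) + length (deadChain (suc i) n)        ≡⟨ length-deadChain (suc i) n ⟩
  dead (suc i + n)                                   ≡⟨ cong dead (sym (+-suc i n)) ⟩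
  dead (i + suc n)                                   ∎
  where open ≡-Reasoning

length-bitAddresses : ∀ {d} a (F : Vec Bool d) → length (bitAddresses a F) ≡ d
length-bitAddresses a []          = refl
length-bitAddresses a (true  ∷ F) = cong suc (length-bitAddresses (suc a) F)
length-bitAddresses a (false ∷ F) = cong suc (length-bitAddresses (suc a) F)

length-tape : ∀ {d} a (Fs : List (Vec Bool d)) → length (tape a Fs) ≡ length Fs * suc d
length-tape a []       = refl
length-tape a (F ∷ Fs) = cong suc
  (trans (length-++ (bitAddresses a F)) (cong₂ _+_ (length-bitAddresses a F) (length-tape a Fs)))

-- The two cells of a node are paid for by one vector passing through it, and a vector meets one
-- node on each of the `d` levels.
length-trie : ∀ d a (T : List (Vec Bool d)) → length (trie d a T) ≤ 2 * (d * length T)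
length-trie d       a []      = z≤n
length-trie zero    a (_ ∷ _) = z≤n
length-trie (suc d) a T@(_ ∷ T′) = begin
  2 + length (trie d a₀ T₀ ++ trie d a₁ T₁)               ≡⟨ cong (2 +_) (length-++ (trie d a₀ T₀)) ⟩
  2 + (length (trie d a₀ T₀) + length (trie d a₁ T₁))     ≤⟨ +-monoʳ-≤ 2 (+-mono-≤ (length-trie d a₀ T₀) (length-trie d a₁ T₁)) ⟩
  2 + (2 * (d * length T₀) + 2 * (d * length T₁))         ≡⟨ collect d (length T₀) (length T₁) ⟩
  2 + 2 * (d * (length T₀ + length T₁))                   ≡⟨ cong (λ l → 2 + 2 * (d * l)) (length-tails T) ⟩
  2 + 2 * (d * suc l)                                     ≤⟨ m≤m+n _ (2 * l) ⟩
  2 + 2 * (d * suc l) + 2 * l                             ≡⟨ regroup d l ⟩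
  2 * (suc d * suc l)                                     ∎
  where
  open ≤-Reasoning
  l  = length T′
  a₀ = suc (suc a)
  T₀ = tails false T
  T₁ = tails true T
  a₁ = a₀ + length (trie d a₀ T₀)
  collect : ∀ d x y → 2 + (2 * (d * x) + 2 * (d * y)) ≡ 2 + 2 * (d * (x + y))
  collect = solve-∀
  regroup : ∀ d l → 2 + 2 * (d * suc l) + 2 * l ≡ 2 * (suc d * suc l)
  regroup = solve-∀

length-structure : ∀ {d} (T Fs : List (Vec Bool d)) →
                   length (Layout.structure T Fs) ≡ Layout.size T Fs
length-structure {d} T Fs = begin
  6 + length (deadChain 0 d ++ trie d trieStart T ++ tape size Fs ++ 0 ∷ [])
    ≡⟨ cong (6 +_) (length-++ (deadChain 0 d)) ⟩
  6 + (length (deadChain 0 d) + length (trie d trieStart T ++ tape size Fs ++ 0 ∷ []))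
    ≡⟨ cong (2 +_) (sym (+-assoc 4 (length (deadChain 0 d)) _)) ⟩
  2 + ((dead 0 + length (deadChain 0 d)) + length (trie d trieStart T ++ tape size Fs ++ 0 ∷ []))
    ≡⟨ cong₂ (λ x y → 2 + (x + y)) (length-deadChain 0 d) (length-++ (trie d trieStart T)) ⟩
  trieStart + (length (trie d trieStart T) + length (tape size Fs ++ 0 ∷ []))
    ≡⟨ sym (+-assoc trieStart _ _) ⟩
  tapeStart + length (tape size Fs ++ 0 ∷ [])
    ≡⟨ cong (tapeStart +_) (trans (length-++ (tape size Fs)) (cong (_+ 1) (length-tape size Fs))) ⟩
  size ∎
  where
  open ≡-Reasoning
  open Layout T Fs

-- The successor is bounded, since a state `q` also uses the cell `q + 1`.
trieState-bound : ∀ d a (T : List (Vec Bool d)) {N} → suc (dead d) < N →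
                  a + length (trie d a T) ≤ N → suc (trieState d a T) < N
trieState-bound d       a []      d< a≤ = d<
trieState-bound zero    a (_ ∷ _) d< a≤ = ≤-<-trans (s≤s z≤n) d<
trieState-bound (suc d) a (_ ∷ _) d< a≤ = ≤-trans
  (subst (suc (suc a) ≤_) (sym (trans (+-suc a _) (cong suc (+-suc a _)))) (s≤s (s≤s (m≤m+n a _)))) a≤

module _ {d} {a N} (T : List (Vec Bool (suc d))) (a≤ : a + length (trieNode d a T) ≤ N) where
  private
    a₀ = suc (suc a)
    T₀ = tails false T
    T₁ = tails true T
    l₀ = length (trie d a₀ T₀)
    l₁ = length (trie d (a₀ + l₀) T₁)

    total : a₀ + l₀ + l₁ ≤ N
    total = subst (_≤ N) (trans (cong (λ l → a + suc (suc l)) (length-++ (trie d a₀ T₀))) (shift a l₀ l₁)) a≤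
      where
      shift : ∀ a x y → a + suc (suc (x + y)) ≡ suc (suc a) + x + y
      shift = solve-∀

  leftBound : a₀ + l₀ ≤ N
  leftBound = ≤-trans (m≤m+n _ l₁) total

  rightBound : a₀ + l₀ + l₁ ≤ N
  rightBound = total

trie-bound : ∀ d a (T : List (Vec Bool d)) {N} → suc (dead d) < N →
             a + length (trie d a T) ≤ N → All (_< N) (trie d a T)
trie-bound d       a []        d< a≤ = []
trie-bound zero    a (_ ∷ _)   d< a≤ = []
trie-bound (suc d) a T@(_ ∷ _) d< a≤ =
  1+m<n⇒m<n (trieState-bound d _ (tails false T) d<′ l) ∷
  1+m<n⇒m<n (trieState-bound d _ (tails true T) d<′ r) ∷
  AllP.++⁺ (trie-bound d _ (tails false T) d<′ l) (trie-bound d _ (tails true T) d<′ r)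
  where
  1+m<n⇒m<n : ∀ {m n} → suc m < n → m < n
  1+m<n⇒m<n = ≤-trans (n≤1+n _)
  d<′ = ≤-trans (n≤1+n _) (≤-trans (n≤1+n _) d<)
  l = leftBound T a≤
  r = rightBound T a≤

deadChain-bound : ∀ i n {N} → dead (i + n) < N → All (_< N) (deadChain i n)
deadChain-bound i zero    h = []
deadChain-bound i (suc n) {N} h = b ∷ b ∷ deadChain-bound (suc i) n h′
  where
  h′ : dead (suc i + n) < N
  h′ = subst (λ x → dead x < N) (+-suc i n) h
  mono : ∀ i n → dead i ≤ dead (i + n)
  mono zero    zero    = ≤-refl
  mono zero    (suc n) = ≤-trans (mono zero n) (≤-trans (n≤1+n _) (n≤1+n _))
  mono (suc i) n       = s≤s (s≤s (mono i n))
  b : dead i < N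
  b = ≤-<-trans (mono i (suc n)) h

bitAddresses-bound : ∀ {d} a (F : Vec Bool d) {N} → 2 < N → a + d ≤ N → All (_< N) (bitAddresses a F)
bitAddresses-bound a []          2< a≤ = []
bitAddresses-bound a (true  ∷ F) {N} 2< a≤ =
  2< ∷ bitAddresses-bound (suc a) F 2< (subst (_≤ N) (+-suc a _) a≤)
bitAddresses-bound a (false ∷ F) {N} 2< a≤ =
  ≤-trans (s≤s (m≤m+n a _)) (subst (_≤ N) (+-suc a _) a≤) ∷
  bitAddresses-bound (suc a) F 2< (subst (_≤ N) (+-suc a _) a≤)

tape-bound : ∀ {d} a (Fs : List (Vec Bool d)) {N} → 2 < N → a + d ≤ N → All (_< N) (tape a Fs)
tape-bound a []       2< a≤ = []
tape-bound a (F ∷ Fs) 2< a≤ =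
  2< ∷ AllP.++⁺ (bitAddresses-bound a F 2< a≤) (tape-bound a Fs 2< a≤)

-- Correctness of the walk through the trie

Reaches : {A : Set} → A → List A → ℕ → Set
Reaches x T q = (x ∈ˡ T × q ≡ 0) ⊎ (¬ x ∈ˡ T × q ≡ 4)

Reaches-tails : ∀ {d} c {v : Vec Bool d} T {q} → Reaches v (tails c T) q → Reaches (c ∷ v) T q
Reaches-tails c T (inj₁ (i , q≡)) = inj₁ (∈-tails⁻ c T i , q≡)
Reaches-tails c T (inj₂ (n , q≡)) = inj₂ ((λ i → n (∈-tails⁺ c T i)) , q≡)

bits : ∀ {d} → Vec Bool d → List ℕ
bits v = List.map bit (toList v)

module Walks (w : ℕ) (M : Word w → Word w) (one : Memory.Holds w M 2 1) where
  open Memory w M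

  Children : ℕ → ℕ → ℕ → Set
  Children q q₀ q₁ = Holds q q₀ × Holds (suc q) q₁

  -- A one of `F` makes the tape point to the constant 1, which overrides the bit `c`; otherwise the
  -- tape points to `c` itself. The property `Q` is a parameter so that trie nodes, dead states and
  -- the accepting state are all served.
  bits-step : ∀ {d q q₀ q₁} {Q : Vec Bool (suc d) → ℕ → Set} f (F : Vec Bool d) c v {a} →
    a ≢ 0 → Segment a (bit c ∷ bits v) → suc q < 2 ^ w → Children q q₀ q₁ →
    (∃[ q′ ] Walk (bitAddresses (suc a) F) q₀ q′ × Q (false ∷ F ∪ v) q′) →
    (∃[ q′ ] Walk (bitAddresses (suc a) F) q₁ q′ × Q (true ∷ F ∪ v) q′) →
    ∃[ q′ ] Walk (bitAddresses a (f ∷ F)) q q′ × Q ((f ∷ F) ∪ (c ∷ v)) q′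
  bits-step {q = q} {q₁ = q₁} true F c v a≢0 seg q< (h₀ , h₁) _ (q′ , walk , r) =
    q′ , step 1 (λ ()) one (subst (_< 2 ^ w) (+-comm 1 q) q<)
      (subst (λ z → Holds z q₁) (+-comm 1 q) h₁) walk , r
  bits-step {q = q} {q₁ = q₁} false F true v a≢0 (h , seg) q< (h₀ , h₁) _ (q′ , walk , r) =
    q′ , step 1 a≢0 h (subst (_< 2 ^ w) (+-comm 1 q) q<)
      (subst (λ z → Holds z q₁) (+-comm 1 q) h₁) walk , r
  bits-step {q = q} {q₀} false F false v a≢0 (h , seg) q< (h₀ , h₁) (q′ , walk , r) _ =
    q′ , step 0 a≢0 h (subst (_< 2 ^ w) (+-comm 0 q) (≤-trans (n≤1+n _) q<))
      (subst (λ z → Holds z q₀) (+-comm 0 q) h₀) walk , r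

  DeadChain : ℕ → Set
  DeadChain d = ∀ i → i < d → Children (dead (suc i)) (dead i) (dead i)

  deadChain-children : ∀ i n → Segment (dead (suc i)) (deadChain i n) →
    ∀ j → i ≤ j → j < i + n → Children (dead (suc j)) (dead j) (dead j)
  deadChain-children i zero    _ j i≤j j< =
    ⊥-elim (<⇒≱ j< (subst (_≤ j) (sym (+-identityʳ i)) i≤j))
  deadChain-children i (suc n) (h₀ , h₁ , seg) j i≤j j< with m≤n⇒m<n∨m≡n i≤j
  ... | inj₂ refl = h₀ , h₁
  ... | inj₁ i<j  = deadChain-children (suc i) n seg j i<j (subst (j <_) (+-suc i n) j<)

  -- Induction on the number of bits left. Once the set of candidates is empty it stays empty and
  -- the walk follows the dead chain, arriving at 4 exactly when the bits of `F` are used up.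
  trie-walk : ∀ d p (T : List (Vec Bool d)) F v {a} → a ≢ 0 → Segment a (bits v) →
    Segment p (trie d p T) → DeadChain d → suc (dead d) < 2 ^ w → p + length (trie d p T) ≤ 2 ^ w →
    ∃[ q ] Walk (bitAddresses a F) (trieState d p T) q × Reaches (F ∪ v) T q
  trie-walk zero p []       [] [] a≢0 seg tr dc d< p≤ = 4 , stop , inj₂ ((λ ()) , refl)
  trie-walk zero p ([] ∷ T) [] [] a≢0 seg tr dc d< p≤ = 0 , stop , inj₁ (here refl , refl)
  trie-walk (suc d) p [] (f ∷ F) (c ∷ v) a≢0 seg tr dc d< p≤ =
    bits-step {Q = λ x → Reaches x []} f F c v a≢0 seg d< (dc d ≤-refl) (next false) (next true)
    where
    next : ∀ e → ∃[ q ] Walk (bitAddresses _ F) (dead d) q × Reaches (e ∷ F ∪ v) [] q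
    next e with trie-walk d p [] F v (λ ()) (proj₂ seg) tt (λ i i< → dc i (≤-trans i< (n≤1+n d)))
                  (≤-trans (n≤1+n _) (≤-trans (n≤1+n _) d<)) p≤
    ... | q , walk , r = q , walk , Reaches-tails e [] r
  trie-walk (suc d) p T@(_ ∷ _) (f ∷ F) (c ∷ v) a≢0 seg (h₀ , h₁ , tr) dc d< p≤ =
    bits-step {Q = λ x → Reaches x T} f F c v a≢0 seg
      (trieState-bound (suc d) p T d< p≤) (h₀ , h₁) next₀ next₁
    where
    p₀ = suc (suc p)
    T₀ = tails false T
    T₁ = tails true T
    p₁ = p₀ + length (trie d p₀ T₀)
    dc′ : DeadChain d
    dc′ i i< = dc i (≤-trans i< (n≤1+n d))
    d<′ = ≤-trans (n≤1+n _) (≤-trans (n≤1+n _) d<)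
    segs = Segment-++ p₀ (trie d p₀ T₀) tr
    next₀ : ∃[ q ] Walk (bitAddresses _ F) (trieState d p₀ T₀) q × Reaches (false ∷ F ∪ v) T q
    next₀ with trie-walk d p₀ T₀ F v (λ ()) (proj₂ seg) (proj₁ segs) dc′ d<′ (leftBound T p≤)
    ... | q , walk , r = q , walk , Reaches-tails false T r
    next₁ : ∃[ q ] Walk (bitAddresses _ F) (trieState d p₁ T₁) q × Reaches (true ∷ F ∪ v) T q
    next₁ with trie-walk d p₁ T₁ F v (λ ()) (proj₂ seg) (proj₂ segs) dc′ d<′ (rightBound T p≤)
    ... | q , walk , r = q , walk , Reaches-tails true T r

  accepted-walk : ∀ {d} (F v : Vec Bool d) {a} → a ≢ 0 → Segment a (bits v) → 1 < 2 ^ w →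
    Children 0 0 0 → Walk (bitAddresses a F) 0 0
  accepted-walk []      []      a≢0 seg 1< acc = stop
  accepted-walk (f ∷ F) (c ∷ v) a≢0 seg 1< acc
    with bits-step {Q = λ _ q → q ≡ 0} f F c v a≢0 seg 1< acc next next
    where
    next : ∃[ q ] Walk (bitAddresses _ F) 0 q × q ≡ 0
    next = 0 , accepted-walk F v (λ ()) (proj₂ seg) 1< acc , refl
  ... | .0 , walk , refl = walk

  module _ {d} (p : ℕ) (T : List (Vec Bool d)) (v : Vec Bool d) {a} (a≢0 : a ≢ 0)
    (vec : Segment a (bits v)) (tr : Segment p (trie d p T)) (dc : DeadChain d)
    (d< : suc (dead d) < 2 ^ w) (5< : 5 < 2 ^ w) (p≤ : p + length (trie d p T) ≤ 2 ^ w)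
    (acc : Children 0 0 0) (rt : Children 4 (trieState d p T) (trieState d p T)) where

    Found : List (Vec Bool d) → Set
    Found = Any (λ F → F ∪ v ∈ˡ T)

    1<2^w : 1 < 2 ^ w
    1<2^w = ≤-trans (s≤s (s≤s z≤n)) 5<

    tape-walk-accepted : ∀ Fs → Walk (tape a Fs) 0 0
    tape-walk-accepted []       = stop
    tape-walk-accepted (F ∷ Fs) = step 1 (λ ()) one 1<2^w (proj₂ acc)
      (Walk-++ (accepted-walk F v a≢0 vec 1<2^w acc) (tape-walk-accepted Fs))

    -- Between two blocks the state is 4 as long as no `F ∪ v` has been found and 0 from then on, so
    -- the last state is the disjunction over all `F`.
    tape-walk : ∀ Fs → ∃[ q ] Walk (tape a Fs) 4 q × ((Found Fs × q ≡ 0) ⊎ (¬ Found Fs × q ≡ 4))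
    tape-walk [] = 4 , stop , inj₂ ((λ ()) , refl)
    tape-walk (F ∷ Fs) with trie-walk d p T F v a≢0 vec tr dc d< p≤ | tape-walk Fs
    ... | _ , walk , inj₁ (i , refl) | _ =
      0 , step 1 (λ ()) one 5< (proj₂ rt) (Walk-++ walk (tape-walk-accepted Fs)) , inj₁ (here i , refl)
    ... | _ , walk , inj₂ (n , refl) | q , walk′ , r =
      q , step 1 (λ ()) one 5< (proj₂ rt) (Walk-++ walk walk′) , extend r
      where
      extend : (Found Fs × q ≡ 0) ⊎ (¬ Found Fs × q ≡ 4) →
               (Found (F ∷ Fs) × q ≡ 0) ⊎ (¬ Found (F ∷ Fs) × q ≡ 4)
      extend (inj₁ (i , q≡)) = inj₁ (there i , q≡)
      extend (inj₂ (m , q≡)) = inj₂ ((λ { (here i) → n i ; (there i) → m i }) , q≡)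

dead≡ : ∀ i → dead i ≡ 4 + 2 * i
dead≡ zero    = refl
dead≡ (suc i) = trans (cong (2 +_) (dead≡ i)) (cong (4 +_) (sym (*-suc 2 i)))

module _ (w : ℕ) {d} (T Fs : List (Vec Bool d)) (v : Vec Bool d) where
  open Layout T Fs

  private
    C : List ℕ
    C = structure ++ bits v

    M : Word w → Word w
    M = tapeMemory w C

    tailCells : List ℕ
    tailCells = tape size Fs ++ 0 ∷ []

  module _ (fits : size + d < 2 ^ w) where
    private
      open Memory w M

      tapeStart<size : tapeStart < size
      tapeStart<size = ≤-trans (≤-reflexive (+-comm 1 tapeStart)) (+-monoʳ-≤ tapeStart (m≤n+m 1 _))

      size< : size < 2 ^ w
      size< = ≤-<-trans (m≤m+n size d) fits

      tapeStart< : tapeStart < 2 ^ w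
      tapeStart< = <-trans tapeStart<size size<

      trieStart< : trieStart < 2 ^ w
      trieStart< = ≤-<-trans (m≤m+n trieStart _) tapeStart<

      6≤trieStart : 6 ≤ trieStart
      6≤trieStart = subst (6 ≤_) (sym (cong (2 +_) (dead≡ d))) (m≤m+n 6 (2 * d))

      5< : 5 < 2 ^ w
      5< = ≤-trans 6≤trieStart (<⇒≤ trieStart<)

      size≢0 : size ≢ 0
      size≢0 eq = <⇒≢ (≤-<-trans z≤n tapeStart<size) (sym eq)

      bits-bound : ∀ {d} (v : Vec Bool d) → All (_< 2 ^ w) (bits v)
      bits-bound []          = []
      bits-bound (false ∷ v) = ≤-trans (s≤s z≤n) 5< ∷ bits-bound v
      bits-bound (true  ∷ v) = ≤-trans (s≤s (s≤s z≤n)) 5< ∷ bits-bound v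

      suc-dead< : suc (dead d) < 2 ^ w
      suc-dead< = <⇒≤ trieStart<

      structure-bound : All (_< 2 ^ w) structure
      structure-bound = ≤-trans (s≤s z≤n) 5< ∷ ≤-trans (s≤s z≤n) 5< ∷ ≤-trans (s≤s (s≤s z≤n)) 5< ∷
        tapeStart< ∷ root< ∷ root< ∷
        AllP.++⁺ (deadChain-bound 0 d (<-trans (n<1+n _) suc-dead<))
          (AllP.++⁺ (trie-bound d trieStart T suc-dead< (<⇒≤ tapeStart<))
            (AllP.++⁺ (tape-bound size Fs (≤-trans (s≤s (s≤s (s≤s z≤n))) 5<) (<⇒≤ fits))
              (≤-trans (s≤s z≤n) 5< ∷ [])))
        where
        root< = <-trans (n<1+n _) (trieState-bound d trieStart T suc-dead< (<⇒≤ tapeStart<))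

      segments : Segment 0 C
      segments = tapeMemory-Segment w C (AllP.++⁺ structure-bound (bits-bound v))

      structureSegment : Segment 0 structure
      structureSegment = proj₁ (Segment-++ 0 structure segments)

      vectorSegment : Segment size (bits v)
      vectorSegment = subst (λ a → Segment a (bits v)) (length-structure T Fs)
        (proj₂ (Segment-++ 0 structure segments))

      chainSegments : Segment 6 (deadChain 0 d) × Segment trieStart (trie d trieStart T ++ tailCells)
      chainSegments with structureSegment
      ... | _ , _ , _ , _ , _ , _ , seg with Segment-++ 6 (deadChain 0 d) seg
      ...   | l , r = l , subst (λ a → Segment a (trie d trieStart T ++ tailCells))
                            (cong (2 +_) (length-deadChain 0 d)) r

      trieSegments : Segment trieStart (trie d trieStart T) × Segment tapeStart tailCells
      trieSegments = Segment-++ trieStart (trie d trieStart T) (proj₂ chainSegments)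

      one : Holds 2 1
      one = proj₁ (proj₂ (proj₂ structureSegment))

    module W = Walks w M one

    walked : ∃[ q ] Walk (tape size Fs) 4 q ×
             ((Any (λ F → F ∪ v ∈ˡ T) Fs × q ≡ 0) ⊎ (¬ Any (λ F → F ∪ v ∈ˡ T) Fs × q ≡ 4))
    walked with structureSegment
    ... | h₀ , h₁ , _ , _ , h₄ , h₅ , _ =
      W.tape-walk trieStart T v size≢0 vectorSegment (proj₁ trieSegments)
        (λ i i< → W.deadChain-children 0 d (proj₁ chainSegments) i z≤n i<)
        suc-dead< 5< (<⇒≤ tapeStart<) (h₀ , h₁) (h₄ , h₅) Fs

    run-structure : ∀ {R t} → t ≡ 8 + 7 * (length Fs * suc d) →
                    ∃[ b ] run walker t (config {w} 0 R M) ≡ just b × (b ≡ true ⇔ Any (λ F → F ∪ v ∈ˡ T) Fs)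
    run-structure {R} t≡ with walked | structureSegment
    ... | q , walk , r | _ , _ , _ , h₃ , _ =
      (q ≡ᵇ 0) ,
      subst (λ t → run walker t (config {w} 0 R M) ≡ just (q ≡ᵇ 0))
        (sym (trans t≡ (cong (λ l → 8 + 7 * l) (sym (length-tape size Fs)))))
        (walker-run (tape size Fs) (<-trans (n<1+n 4) 5<) h₃ (proj₂ trieSegments) inTape walk) ,
      decide r
      where
      inTape : tapeStart + length (tape size Fs) < 2 ^ w
      inTape = ≤-<-trans (+-monoʳ-≤ tapeStart (≤-trans (≤-reflexive (length-tape size Fs)) (m≤m+n _ 1))) size<
      decide : ∀ {q} {A : Set} → (A × q ≡ 0) ⊎ (¬ A × q ≡ 4) → (q ≡ᵇ 0) ≡ true ⇔ A
      decide (inj₁ (a , refl)) = mk⇔ (λ _ → a) (λ _ → refl)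
      decide (inj₂ (n , refl)) = mk⇔ (λ ()) (λ a → ⊥-elim (n a))

  -- The number of steps is a variable because run unfolds on a numeral.
  answer-structure : size + d < 2 ^ w → ∀ {t} → t ≡ 8 + 7 * (length Fs * suc d) →
    ∃[ b ] run walker t (initial w (List.map (trunc w) structure) v) ≡ just b ×
           (b ≡ true ⇔ Any (λ F → F ∪ v ∈ˡ T) Fs)
  answer-structure fits {t} t≡ = subst Answers cells≡ (run-structure fits t≡)
    where
    R : Reg → Word w
    R = update _≟_ (λ _ → trunc w 0) 0 (trunc w (length (List.map (trunc w) structure)))
    Answers : List (Word w) → Set
    Answers cells = ∃[ b ]
      run walker t
        (config {w} 0 R (λ a → fromMaybe (trunc w 0) (cells !? toℕ a))) ≡ just b ×
      (b ≡ true ⇔ Any (λ F → F ∪ v ∈ˡ T) Fs)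
    cells≡ : List.map (trunc w) C ≡
             List.map (trunc w) structure ++ List.map (λ b → trunc w (bit b)) (toList v)
    cells≡ = trans (map-++ (trunc w) structure (bits v))
                   (cong (List.map (trunc w) structure ++_) (sym (map-∘ (toList v))))

-- Stored queries

Orthogonal-tail : ∀ {d a b} {u v : Vec Bool d} → Orthogonal (a ∷ u) (b ∷ v) → Orthogonal u v
Orthogonal-tail o (i , p) = o (Fin.suc i , p)

Orthogonal-∷ : ∀ {d a b} {u v : Vec Bool d} → ¬ (a ≡ true × b ≡ true) →
               Orthogonal u v → Orthogonal (a ∷ u) (b ∷ v)
Orthogonal-∷ h o (Fin.zero  , p) = h p
Orthogonal-∷ h o (Fin.suc i , p) = o (i , p)

Orthogonal? : ∀ {d} (u v : Vec Bool d) → Dec (Orthogonal u v)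
Orthogonal? u v =
  ¬? (FinP.any? (λ i → (lookup u i Bool.≟ true) ×-dec (lookup v i Bool.≟ true)))

HasOrthogonal? : ∀ {n d} (S : Vec (Vec Bool d) n) (v : Vec Bool d) → Dec (HasOrthogonal S v)
HasOrthogonal? S v =
  map′ find (λ (u , u∈S , o) → lose u∈S o) (VecAny.any? (λ u → Orthogonal? u v) S)

Orthogonal-∪⁻ : ∀ {d} (u F v : Vec Bool d) → Orthogonal u (F ∪ v) → Orthogonal u v
Orthogonal-∪⁻ []      []      []      o = o
Orthogonal-∪⁻ (a ∷ u) (f ∷ F) (b ∷ v) o =
  Orthogonal-∷ (λ { (refl , refl) → o (Fin.zero , refl , ∨-true f) })
               (Orthogonal-∪⁻ u F v (Orthogonal-tail o))
  where
  ∨-true : ∀ f → f ∨ true ≡ true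
  ∨-true false = refl
  ∨-true true  = refl

∅ : ∀ {d} → Vec Bool d
∅ = Vec.replicate _ false

∅-∪ : ∀ {d} (v : Vec Bool d) → ∅ ∪ v ≡ v
∅-∪ []      = refl
∅-∪ (x ∷ v) = cong (x ∷_) (∅-∪ v)

∁ : ∀ {d} → Vec Bool d → Vec Bool d
∁ = Vec.map not

ones zeros : ∀ {d} → Vec Bool d → ℕ
ones []          = 0
ones (true  ∷ v) = suc (ones v)
ones (false ∷ v) = ones v
zeros v = ones (∁ v)

ones+zeros : ∀ {d} (v : Vec Bool d) → ones v + zeros v ≡ d
ones+zeros []          = refl
ones+zeros (true  ∷ v) = cong suc (ones+zeros v)
ones+zeros (false ∷ v) = trans (+-suc (ones v) (zeros v)) (cong suc (ones+zeros v))

ones-∅ : ∀ d → ones (∅ {d}) ≡ 0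
ones-∅ zero    = refl
ones-∅ (suc d) = ones-∅ d

∁-∪-orthogonal : ∀ {d} (F u : Vec Bool d) → Orthogonal u (∁ (F ∪ u))
∁-∪-orthogonal []      []      (() , _)
∁-∪-orthogonal (f ∷ F) (a ∷ u) = Orthogonal-∷ (λ { (refl , p) → clash f p }) (∁-∪-orthogonal F u)
  where
  clash : ∀ f → not (f ∨ true) ≢ true
  clash false ()
  clash true  ()

-- For orthogonal `u` and `v` the sets `u`, `v` and `∁ (u ∪ v)` partition the coordinates. So `v` is
-- obtained from `u` through an `F` whose weight is the distance of `v` from `∁ u`.
∁-recover : ∀ {d} (u v : Vec Bool d) → Orthogonal u v → ∁ (∁ (u ∪ v) ∪ u) ≡ v
∁-recover []          []          o = refl
∁-recover (false ∷ u) (false ∷ v) o = cong (false ∷_) (∁-recover u v (Orthogonal-tail o))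
∁-recover (false ∷ u) (true  ∷ v) o = cong (true ∷_) (∁-recover u v (Orthogonal-tail o))
∁-recover (true  ∷ u) (false ∷ v) o = cong (false ∷_) (∁-recover u v (Orthogonal-tail o))
∁-recover (true  ∷ u) (true  ∷ v) o = ⊥-elim (o (Fin.zero , refl , refl))

-- The ones of `F` are put on the first `s` coordinates where both `u` and `v` vanish: there they
-- add to the ones of `v` and cannot meet those of `u`.
raise : ∀ {d} (u v : Vec Bool d) s → Orthogonal u v → s ≤ zeros (u ∪ v) →
        ∃[ F ] ones F ≡ s × ones (F ∪ v) ≡ s + ones v × Orthogonal u (F ∪ v)
raise {d} u v zero o s≤ =
  ∅ , ones-∅ d , cong ones (∅-∪ v) , subst (Orthogonal u) (sym (∅-∪ v)) o
raise [] [] (suc s) o ()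
raise (false ∷ u) (false ∷ v) (suc s) o (s≤s s≤) with raise u v s (Orthogonal-tail o) s≤
... | F , p , q , r = true ∷ F , cong suc p , cong suc q , Orthogonal-∷ (λ { (() , _) }) r
raise (false ∷ u) (true ∷ v) (suc s) o s≤ with raise u v (suc s) (Orthogonal-tail o) s≤
... | F , p , q , r = false ∷ F , p , cong suc (trans q (sym (+-suc s (ones v)))) , Orthogonal-∷ (λ { (() , _) }) r
raise (true ∷ u) (false ∷ v) (suc s) o s≤ with raise u v (suc s) (Orthogonal-tail o) s≤
... | F , p , q , r = false ∷ F , p , q , Orthogonal-∷ (λ { (_ , ()) }) r
raise (true ∷ u) (true ∷ v) (suc s) o s≤ = ⊥-elim (o (Fin.zero , refl , refl))

cube : ∀ d → List (Vec Bool d)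
cube zero    = [] ∷ []
cube (suc d) = List.map (true ∷_) (cube d) ++ List.map (false ∷_) (cube d)

∈-cube : ∀ {d} (v : Vec Bool d) → v ∈ˡ cube d
∈-cube []          = here refl
∈-cube (true  ∷ v) = ∈-++⁺ˡ (∈-map⁺ (true ∷_) (∈-cube v))
∈-cube (false ∷ v) = ∈-++⁺ʳ _ (∈-map⁺ (false ∷_) (∈-cube v))

light : ∀ {d} → ℕ → List (Vec Bool d)
light s = filter (λ F → ones F ≤? s) (cube _)

∈-light : ∀ {d s} {F : Vec Bool d} → ones F ≤ s → F ∈ˡ light s
∈-light = ∈-filter⁺ (λ F → ones F ≤? _) (∈-cube _)

module Stored {n d} (h s : ℕ) (S : Vec (Vec Bool d) n) where
  heavyQuery? : ∀ v → Dec (h ≤ ones v × HasOrthogonal S v)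
  heavyQuery? v = (h ≤? ones v) ×-dec HasOrthogonal? S v

  lightQuery? : ∀ v → Dec (h ≤ zeros v × HasOrthogonal S v)
  lightQuery? v = (h ≤? zeros v) ×-dec HasOrthogonal? S v

  heavyQueries lightQueries nearQueries stored : List (Vec Bool d)
  heavyQueries = filter heavyQuery? (cube d)
  lightQueries = filter lightQuery? (cube d)
  nearQueries  = concatMap (λ u → List.map (λ F → ∁ (F ∪ u)) (light s)) (toList S)
  stored       = heavyQueries ++ lightQueries ++ nearQueries

  stored-sound : ∀ {v} → v ∈ˡ stored → HasOrthogonal S v
  stored-sound v∈ with ∈-++⁻ heavyQueries v∈
  ... | inj₁ i = proj₂ (proj₂ (∈-filter⁻ heavyQuery? {xs = cube d} i))
  ... | inj₂ i with ∈-++⁻ lightQueries i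
  ...   | inj₁ j = proj₂ (proj₂ (∈-filter⁻ lightQuery? {xs = cube d} j))
  ...   | inj₂ j with findˡ (∈-concatMap⁻ _ {xs = toList S} j)
  ...     | u , u∈ , v∈u with ∈-map⁻ (λ F → ∁ (F ∪ u)) v∈u
  ...       | F , _ , refl = u , ∈-toList⁻ u∈ , ∁-∪-orthogonal F u

  stored-heavy : ∀ {v} → h ≤ ones v → HasOrthogonal S v → v ∈ˡ stored
  stored-heavy h≤ y = ∈-++⁺ˡ (∈-filter⁺ heavyQuery? (∈-cube _) (h≤ , y))

  stored-light : ∀ {v} → h ≤ zeros v → HasOrthogonal S v → v ∈ˡ stored
  stored-light h≤ y =
    ∈-++⁺ʳ heavyQueries (∈-++⁺ˡ (∈-filter⁺ lightQuery? (∈-cube _) (h≤ , y)))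

  stored-near : ∀ {u v} → u ∈ S → Orthogonal u v → zeros (u ∪ v) ≤ s → v ∈ˡ stored
  stored-near {u} {v} u∈ o s≤ = ∈-++⁺ʳ heavyQueries (∈-++⁺ʳ lightQueries
    (∈-concatMap⁺ _ (loseˡ (∈-toList⁺ u∈)
      (subst (_∈ˡ List.map (λ F → ∁ (F ∪ u)) (light s)) (∁-recover u v o)
        (∈-map⁺ (λ F → ∁ (F ∪ u)) (∈-light s≤))))))

  ∅-found : ∀ {v} → v ∈ˡ stored → Any (λ F → F ∪ v ∈ˡ stored) (light s)
  ∅-found {v} v∈ = loseˡ
    (∈-light (subst (_≤ s) (sym (ones-∅ d)) z≤n)) (subst (_∈ˡ stored) (sym (∅-∪ v)) v∈)

  -- A query near the middle layer that is far from the complement of every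
  -- witness u can be raised within the complement of u to the heavy layers.
  stored-complete : 2 * h ≤ d + s → ∀ v → HasOrthogonal S v → Any (λ F → F ∪ v ∈ˡ stored) (light s)
  stored-complete 2h≤ v y@(u , u∈ , o) with h ≤? ones v | h ≤? zeros v | zeros (u ∪ v) ≤? s
  ... | yes h≤ | _      | _      = ∅-found (stored-heavy h≤ y)
  ... | no  _  | yes h≤ | _      = ∅-found (stored-light h≤ y)
  ... | no  _  | no  _  | yes s≤ = ∅-found (stored-near u∈ o s≤)
  ... | no  _  | no h≰  | no s≰ with raise u v s o (<⇒≤ (≰⇒> s≰))
  ...   | F , p , q , r = loseˡ {x = F}
          (∈-light (≤-reflexive p)) (stored-heavy (subst (h ≤_) (sym q) h≤) (u , u∈ , r))
    where
    -- Since `v` is not stored as a light query, `zeros v` is below `h`; subtracting it from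
    -- `2 * h ≤ d + s` leaves at least `h` for `s + ones v`.
    h≤ : h ≤ s + ones v
    h≤ = +-cancelʳ-≤ (zeros v) h (s + ones v) (begin
      h + zeros v             ≤⟨ +-monoʳ-≤ h (<⇒≤ (≰⇒> h≰)) ⟩
      h + h                   ≡⟨ cong (h +_) (sym (+-identityʳ h)) ⟩
      2 * h                   ≤⟨ 2h≤ ⟩
      d + s                   ≡⟨ cong (_+ s) (sym (ones+zeros v)) ⟩
      ones v + zeros v + s    ≡⟨ shuffle (ones v) (zeros v) s ⟩
      s + ones v + zeros v    ∎)
      where
      open ≤-Reasoning
      shuffle : ∀ a b c → a + b + c ≡ c + a + b
      shuffle = solve-∀

  found⇔HasOrthogonal : 2 * h ≤ d + s → ∀ v →
                        Any (λ F → F ∪ v ∈ˡ stored) (light s) ⇔ HasOrthogonal S v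
  found⇔HasOrthogonal 2h≤ v = mk⇔ sound (stored-complete 2h≤ v)
    where
    sound : Any (λ F → F ∪ v ∈ˡ stored) (light s) → HasOrthogonal S v
    sound i with findˡ i
    ... | F , _ , F∪v∈ with stored-sound F∪v∈
    ...   | u , u∈ , o = u , u∈ , Orthogonal-∪⁻ u F v o

  length-near : length nearQueries ≡ n * length (light {d} s)
  length-near = trans (go (toList S)) (cong (_* length (light {d} s)) (length-toList S))
    where
    go : ∀ us → length (concatMap (λ u → List.map (λ F → ∁ (F ∪ u)) (light s)) us) ≡
                length us * length (light {d} s)
    go []       = refl
    go (u ∷ us) = trans (length-++ (List.map (λ F → ∁ (F ∪ u)) (light s)))
                        (cong₂ _+_ (length-map _ (light {d} s)) (go us))

-- Counting by weights on the cube

weight : ∀ {d} → ℕ → ℕ → Vec Bool d → ℕ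
weight a b v = a ^ ones v * b ^ zeros v

sum-map-* : ∀ {A : Set} c (f : A → ℕ) xs → sum (List.map (λ x → c * f x) xs) ≡ c * sum (List.map f xs)
sum-map-* c f []       = sym (*-zeroʳ c)
sum-map-* c f (x ∷ xs) = trans (cong (c * f x +_) (sum-map-* c f xs)) (sym (*-distribˡ-+ c (f x) _))

-- The binomial theorem, with vectors in place of binomial coefficients: splitting off a coordinate
-- multiplies the total by `a + b`.
sum-weight-cube : ∀ a b d → sum (List.map (weight a b) (cube d)) ≡ (a + b) ^ d
sum-weight-cube a b zero    = refl
sum-weight-cube a b (suc d) = begin
  sum (List.map (weight a b) (List.map (true ∷_) (cube d) ++ List.map (false ∷_) (cube d)))
    ≡⟨ cong sum (map-++ (weight a b) (List.map (true ∷_) (cube d)) _) ⟩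
  sum (List.map (weight a b) (List.map (true ∷_) (cube d)) ++
       List.map (weight a b) (List.map (false ∷_) (cube d)))
    ≡⟨ sum-++ (List.map (weight a b) (List.map (true ∷_) (cube d))) _ ⟩
  sum (List.map (weight a b) (List.map (true ∷_) (cube d))) +
  sum (List.map (weight a b) (List.map (false ∷_) (cube d)))
    ≡⟨ cong₂ _+_ (face true a (λ v → *-assoc a (a ^ ones v) (b ^ zeros v)))
                 (face false b (λ v → swap (a ^ ones v) b (b ^ zeros v))) ⟩
  a * (a + b) ^ d + b * (a + b) ^ d
    ≡⟨ sym (*-distribʳ-+ ((a + b) ^ d) a b) ⟩
  (a + b) ^ suc d ∎
  where
  open ≡-Reasoning
  swap : ∀ x b y → x * (b * y) ≡ b * (x * y)
  swap = solve-∀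
  face : ∀ e c → (∀ v → weight a b (e ∷ v) ≡ c * weight a b v) →
         sum (List.map (weight a b) (List.map (e ∷_) (cube d))) ≡ c * (a + b) ^ d
  face e c h = trans (cong sum (trans (sym (map-∘ (cube d))) (map-cong h (cube d))))
    (trans (sum-map-* c (weight a b) (cube d)) (cong (c *_) (sum-weight-cube a b d)))

-- Markov's inequality for the counting measure.
filter-bound : ∀ {A : Set} {P : A → Set} (P? : ∀ x → Dec (P x)) (f : A → ℕ) g → (∀ x → P x → g ≤ f x) →
               ∀ xs → length (filter P? xs) * g ≤ sum (List.map f xs)
filter-bound P? f g h []       = z≤n
filter-bound P? f g h (x ∷ xs) with P? x
... | yes p = +-mono-≤ (h x p) (filter-bound P? f g h xs)
... | no  _ = ≤-trans (filter-bound P? f g h xs) (m≤n+m _ (f x))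

-- Turning factors `b` into factors `a ≥ b` does not decrease the product. Hence among the vectors
-- of a tail the weight is least on the threshold layer.
^-tradeoff : ∀ {a b p q p′ q′} → b ≤ a → p ≤ p′ → p + q ≡ p′ + q′ → a ^ p * b ^ q ≤ a ^ p′ * b ^ q′
^-tradeoff {a} {b} {p} {q} {p′} {q′} b≤a p≤p′ eq with m≤n⇒∃[o]m+o≡n p≤p′
... | x , refl = begin
  a ^ p * b ^ q             ≡⟨ cong (λ z → a ^ p * b ^ z) q≡ ⟩
  a ^ p * b ^ (x + q′)      ≡⟨ cong (a ^ p *_) (^-distribˡ-+-* b x q′) ⟩
  a ^ p * (b ^ x * b ^ q′)  ≤⟨ *-monoʳ-≤ (a ^ p) (*-monoˡ-≤ (b ^ q′) (^-monoˡ-≤ x b≤a)) ⟩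
  a ^ p * (a ^ x * b ^ q′)  ≡⟨ sym (*-assoc (a ^ p) (a ^ x) (b ^ q′)) ⟩
  a ^ p * a ^ x * b ^ q′    ≡⟨ cong (_* b ^ q′) (sym (^-distribˡ-+-* a p x)) ⟩
  a ^ (p + x) * b ^ q′      ∎
  where
  open ≤-Reasoning
  q≡ : q ≡ x + q′
  q≡ = +-cancelˡ-≡ p q (x + q′) (trans eq (+-assoc p x q′))

module Counts {n d} (h s : ℕ) (S : Vec (Vec Bool d) n) where
  open Stored h s S

  -- A Chernoff bound: a weight biased towards ones makes every heavy vector weigh at least as much
  -- as one of the threshold layer, and `filter-bound` applies.
  length-heavy : ∀ a b l → b ≤ a → h + l ≡ d → length heavyQueries * (a ^ h * b ^ l) ≤ (a + b) ^ d
  length-heavy a b l b≤a eq = ≤-trans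
    (filter-bound heavyQuery? (weight a b) _
      (λ v (h≤ , _) → ^-tradeoff b≤a h≤ (trans eq (sym (ones+zeros v)))) (cube d))
    (≤-reflexive (sum-weight-cube a b d))

  length-lightQueries : ∀ a b l → b ≤ a → h + l ≡ d → length lightQueries * (a ^ h * b ^ l) ≤ (b + a) ^ d
  length-lightQueries a b l b≤a eq = ≤-trans
    (filter-bound lightQuery? (weight b a) _
      (λ v (h≤ , _) → ≤-trans (^-tradeoff b≤a h≤ (trans eq (trans (sym (ones+zeros v)) (+-comm (ones v) _))))
                              (≤-reflexive (*-comm (a ^ zeros v) _))) (cube d))
    (≤-reflexive (sum-weight-cube b a d))

length-light : ∀ {d} s b l → l + s ≡ d → .{{_ : NonZero b}} → length (light {d} s) * b ^ l ≤ (1 + b) ^ d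
length-light {d} s b l eq = ≤-trans
  (filter-bound (λ F → ones F ≤? s) (weight 1 b) (b ^ l)
    (λ v ≤s → ≤-trans (^-monoʳ-≤ b (l≤ v ≤s)) (≤-reflexive (sym (trans (cong (_* b ^ zeros v) (^-zeroˡ (ones v))) (*-identityˡ _)))))
    (cube d))
  (≤-reflexive (sum-weight-cube 1 b d))
  where
  l≤ : ∀ v → ones v ≤ s → l ≤ zeros v
  l≤ v ≤s = +-cancelʳ-≤ s l (zeros v) (begin
    l + s              ≡⟨ trans eq (sym (ones+zeros v)) ⟩
    ones v + zeros v   ≤⟨ +-monoˡ-≤ (zeros v) ≤s ⟩
    s + zeros v        ≡⟨ +-comm s (zeros v) ⟩
    zeros v + s        ∎)
    where open ≤-Reasoning

length-cube : ∀ d → length (cube d) ≡ 2 ^ d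
length-cube zero    = refl
length-cube (suc d) = trans (length-++ (List.map (true ∷_) (cube d)))
  (trans (cong₂ _+_ (trans (length-map _ (cube d)) (length-cube d)) (trans (length-map _ (cube d)) (length-cube d)))
         (cong (2 ^ d +_) (sym (+-identityʳ (2 ^ d)))))

-- Exponential inequalities

^-distribʳ-* : ∀ m n o → (m * n) ^ o ≡ m ^ o * n ^ o
^-distribʳ-* m n zero    = refl
^-distribʳ-* m n (suc o) = trans (cong (m * n *_) (^-distribʳ-* m n o)) (shuffle m n (m ^ o) (n ^ o))
  where
  shuffle : ∀ a b c d → a * b * (c * d) ≡ a * c * (b * d)
  shuffle = solve-∀

^-swap : ∀ m n o → (m ^ n) ^ o ≡ (m ^ o) ^ n
^-swap m n o = trans (^-*-assoc m n o) (trans (cong (m ^_) (*-comm n o)) (sym (^-*-assoc m o n)))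

^-cancelˡ-≤ : ∀ {m n} o .{{_ : NonZero o}} → m ^ o ≤ n ^ o → m ≤ n
^-cancelˡ-≤ {m} {n} o h with m ≤? n
... | yes m≤n = m≤n
... | no  m≰n = contradiction h (<⇒≱ (^-monoˡ-< o (≰⇒> m≰n)))

n<2^n : ∀ n → n < 2 ^ n
n<2^n zero    = s≤s z≤n
n<2^n (suc n) = ≤-trans (+-mono-≤ (≤-trans (s≤s z≤n) (n<2^n n)) (n<2^n n))
                        (≤-reflexive (cong (2 ^ n +_) (sym (+-identityʳ (2 ^ n)))))

m≤m*n′ : ∀ m {n} → 1 ≤ n → m ≤ m * n
m≤m*n′ m 1≤n = ≤-trans (≤-reflexive (sym (*-identityʳ m))) (*-monoʳ-≤ m 1≤n)

-- With `x = Q - i` this is (1 + 1/Q)^i ≤ 1 / (1 - i/Q), cleared of denominators.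
bernoulli-upper : ∀ {Q} i x → i + x ≡ Q → (1 + Q) ^ i * x ≤ Q ^ i * Q
bernoulli-upper zero    x refl = ≤-refl
bernoulli-upper {Q} (suc i) x eq = begin
  (1 + Q) * (1 + Q) ^ i * x      ≡⟨ rotate (1 + Q) ((1 + Q) ^ i) x ⟩
  (1 + Q) ^ i * ((1 + Q) * x)    ≤⟨ *-monoʳ-≤ ((1 + Q) ^ i) (begin
     x + Q * x                     ≤⟨ +-monoˡ-≤ (Q * x) (subst (x ≤_) eq (m≤n+m x (suc i))) ⟩
     Q + Q * x                     ≡⟨ sym (*-suc Q x) ⟩
     Q * suc x                     ∎) ⟩
  (1 + Q) ^ i * (Q * suc x)      ≡⟨ sym (rotate Q ((1 + Q) ^ i) (suc x)) ⟩
  Q * (1 + Q) ^ i * suc x        ≡⟨ *-assoc Q _ (suc x) ⟩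
  Q * ((1 + Q) ^ i * suc x)      ≤⟨ *-monoʳ-≤ Q (bernoulli-upper i (suc x) (trans (+-suc i x) eq)) ⟩
  Q * (Q ^ i * Q)                ≡⟨ sym (*-assoc Q (Q ^ i) Q) ⟩
  Q * Q ^ i * Q                  ∎
  where
  open ≤-Reasoning
  rotate : ∀ a b c → a * b * c ≡ b * (a * c)
  rotate = solve-∀

-- Bernoulli's inequality 1 + n/x ≤ (1 + 1/x)^n, cleared of denominators.
bernoulli-lower : ∀ x n → x ^ n * (x + n) ≤ x * (1 + x) ^ n
bernoulli-lower x zero = ≤-reflexive (trans (*-identityˡ (x + 0)) (trans (+-identityʳ x) (sym (*-identityʳ x))))
bernoulli-lower x (suc n) = begin
  x * x ^ n * (x + suc n)              ≤⟨ m≤m+n _ (x ^ n * n) ⟩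
  x * x ^ n * (x + suc n) + x ^ n * n  ≡⟨ collect x n (x ^ n) ⟩
  (1 + x) * (x ^ n * (x + n))          ≤⟨ *-monoʳ-≤ (1 + x) (bernoulli-lower x n) ⟩
  (1 + x) * (x * (1 + x) ^ n)          ≡⟨ swap (1 + x) x ((1 + x) ^ n) ⟩
  x * ((1 + x) * (1 + x) ^ n)          ∎
  where
  open ≤-Reasoning
  collect : ∀ x n y → x * y * (x + (1 + n)) + y * n ≡ (1 + x) * (y * (x + n))
  collect = solve-∀
  swap : ∀ a b c → a * (b * c) ≡ b * (a * c)
  swap = solve-∀

-- A strict inequality of integers becomes a factor 2 after taking the `x`-th power, since (1 +
-- 1/x)^x ≥ 2. This turns `entropy-gap` into a saving that needs no logarithms.
doubling : ∀ x {z} → .{{_ : NonZero x}} → x < z → 2 * x ^ x ≤ z ^ x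
doubling x {z} x<z = ≤-trans (*-cancelˡ-≤ x (begin
  x * (2 * x ^ x)   ≡⟨ shuffle x (x ^ x) ⟩
  x ^ x * (x + x)   ≤⟨ bernoulli-lower x x ⟩
  x * (1 + x) ^ x   ∎)) (^-monoˡ-≤ x x<z)
  where
  open ≤-Reasoning
  shuffle : ∀ x y → x * (2 * y) ≡ y * (x + x)
  shuffle = solve-∀

halving : ∀ n → .{{_ : NonZero n}} → (1 + 2 * n) ^ n ≤ 2 * (2 * n) ^ n
halving n = *-cancelʳ-≤ _ _ n (begin
  (1 + 2 * n) ^ n * n      ≤⟨ bernoulli-upper n n (cong (n +_) (sym (+-identityʳ n))) ⟩
  (2 * n) ^ n * (2 * n)    ≡⟨ shuffle ((2 * n) ^ n) n ⟩
  2 * (2 * n) ^ n * n      ∎)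
  where
  open ≤-Reasoning
  shuffle : ∀ x n → x * (2 * n) ≡ 2 * x * n
  shuffle = solve-∀

-- The `j`-th power of d + 1 ≤ j (⌊d/j⌋ + 1) ≤ j · 2^⌊d/j⌋. It lets factors polynomial in `d` be
-- absorbed by an arbitrarily small power of 2^d.
polynomial≤exponential : ∀ j d → .{{_ : NonZero j}} → suc d ^ j ≤ j ^ j * 2 ^ d
polynomial≤exponential j d = begin
  suc d ^ j                      ≤⟨ ^-monoˡ-≤ j base ⟩
  (j * 2 ^ (d / j)) ^ j          ≡⟨ ^-distribʳ-* j (2 ^ (d / j)) j ⟩
  j ^ j * (2 ^ (d / j)) ^ j      ≡⟨ cong (j ^ j *_) (^-*-assoc 2 (d / j) j) ⟩
  j ^ j * 2 ^ (d / j * j)        ≤⟨ *-monoʳ-≤ (j ^ j) (^-monoʳ-≤ 2 (subst (d / j * j ≤_) (sym (m≡m%n+[m/n]*n d j)) (m≤n+m _ (d % j)))) ⟩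
  j ^ j * 2 ^ d                  ∎
  where
  open ≤-Reasoning
  base : suc d ≤ j * 2 ^ (d / j)
  base = begin
    suc d                        ≡⟨ cong suc (m≡m%n+[m/n]*n d j) ⟩
    suc (d % j) + d / j * j      ≤⟨ +-monoˡ-≤ (d / j * j) (m%n<n d j) ⟩
    j + d / j * j                ≡⟨ *-comm (suc (d / j)) j ⟩
    j * suc (d / j)              ≤⟨ *-monoʳ-≤ j (n<2^n (d / j)) ⟩
    j * 2 ^ (d / j)              ∎

-- For N vectors of weight at most 2m the bound N · b^(d - 2m) ≤ (1 + b)^d
-- is used with b = 4j, where (1 + 1/b)^(2j) ≤ 2.
light-exponent : ∀ j d m l N → .{{_ : NonZero j}} → l + 2 * m ≡ d → 16 * (j * j) * m ≤ d →
                 N * (4 * j) ^ l ≤ (1 + 4 * j) ^ d → N ^ j ≤ 2 ^ d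
light-exponent j@(suc _) d m l N eq m≤ h =
  -- The square of N^j is bounded because two factors 2^d arise: one from `root`, one from the 2m
  -- powers of `B` by which `d` exceeds `l`.
  ^-cancelˡ-≤ 2 (*-cancelʳ-≤ _ _ (B ^ (l * J)) {{m^n≢0 B (l * J)}} (begin
    (N ^ j) ^ 2 * B ^ (l * J)            ≡⟨ cong₂ _*_ (trans (^-*-assoc N j 2) (cong (N ^_) (*-comm j 2))) (sym (^-*-assoc B l J)) ⟩
    N ^ J * (B ^ l) ^ J                  ≡⟨ sym (^-distribʳ-* N (B ^ l) J) ⟩
    (N * B ^ l) ^ J                      ≤⟨ ^-monoˡ-≤ J h ⟩
    ((1 + B) ^ d) ^ J                    ≡⟨ ^-swap (1 + B) d J ⟩
    ((1 + B) ^ J) ^ d                    ≤⟨ ^-monoˡ-≤ d root ⟩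
    (2 * B ^ J) ^ d                      ≡⟨ ^-distribʳ-* 2 (B ^ J) d ⟩
    2 ^ d * (B ^ J) ^ d                  ≡⟨ cong (2 ^ d *_) split ⟩
    2 ^ d * (B ^ (2 * m * J) * B ^ (l * J))  ≤⟨ *-monoʳ-≤ (2 ^ d) (*-monoˡ-≤ (B ^ (l * J)) small) ⟩
    2 ^ d * (2 ^ d * B ^ (l * J))        ≡⟨ shuffle (2 ^ d) (B ^ (l * J)) ⟩
    (2 ^ d) ^ 2 * B ^ (l * J)            ∎))
  where
  open ≤-Reasoning
  B = 4 * j
  J = 2 * j
  shuffle : ∀ x y → x * (x * y) ≡ x * (x * 1) * y
  shuffle = solve-∀
  B≡ : 2 * J ≡ B
  B≡ = sym (*-assoc 2 2 j)
  root : (1 + B) ^ J ≤ 2 * B ^ J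
  root = subst (λ b → (1 + b) ^ J ≤ 2 * b ^ J) B≡ (halving J)
  split : (B ^ J) ^ d ≡ B ^ (2 * m * J) * B ^ (l * J)
  split = trans (^-*-assoc B J d) (trans (cong (B ^_) (trans (cong (J *_) (sym eq)) (expand J l m)))
    (^-distribˡ-+-* B (2 * m * J) (l * J)))
    where
    expand : ∀ J l m → J * (l + 2 * m) ≡ 2 * m * J + l * J
    expand = solve-∀
  small : B ^ (2 * m * J) ≤ 2 ^ d
  small = begin
    B ^ (2 * m * J)            ≤⟨ ^-monoˡ-≤ (2 * m * J) (<⇒≤ (n<2^n B)) ⟩
    (2 ^ B) ^ (2 * m * J)      ≡⟨ ^-*-assoc 2 B (2 * m * J) ⟩
    2 ^ (B * (2 * m * J))      ≡⟨ cong (2 ^_) (expand j m) ⟩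
    2 ^ (16 * (j * j) * m)     ≤⟨ ^-monoʳ-≤ 2 m≤ ⟩
    2 ^ d                      ∎
    where
    expand : ∀ j m → 4 * j * (2 * m * (2 * j)) ≡ 16 * (j * j) * m
    expand = solve-∀

-- A ≤ C^(1/R) · 2^(d (1 - 1/R)).
Gap : ℕ → ℕ → ℕ → ℕ → Set
Gap R C d A = A ^ R * 2 ^ d ≤ C * 2 ^ (d * R)

Gap-+ : ∀ R {C C′ d A A′} → Gap R C d A → Gap R C′ d A′ → Gap R (2 ^ R * (C + C′)) d (A + A′)
Gap-+ R {C} {C′} {d} {A} {A′} g g′ with ≤-total A A′
... | inj₁ A≤A′ = begin
  (A + A′) ^ R * 2 ^ d                 ≤⟨ *-monoˡ-≤ (2 ^ d) (^-monoˡ-≤ R (+-mono-≤ A≤A′ (m≤m+n A′ 0))) ⟩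
  (2 * A′) ^ R * 2 ^ d                 ≡⟨ trans (cong (_* 2 ^ d) (^-distribʳ-* 2 A′ R)) (*-assoc (2 ^ R) _ _) ⟩
  2 ^ R * (A′ ^ R * 2 ^ d)             ≤⟨ *-monoʳ-≤ (2 ^ R) (≤-trans g′ (*-monoˡ-≤ (2 ^ (d * R)) (m≤n+m C′ C))) ⟩
  2 ^ R * ((C + C′) * 2 ^ (d * R))     ≡⟨ sym (*-assoc (2 ^ R) _ _) ⟩
  2 ^ R * (C + C′) * 2 ^ (d * R)       ∎
  where open ≤-Reasoning
... | inj₂ A′≤A = begin
  (A + A′) ^ R * 2 ^ d                 ≤⟨ *-monoˡ-≤ (2 ^ d) (^-monoˡ-≤ R (+-monoʳ-≤ A (≤-trans A′≤A (m≤m+n A 0)))) ⟩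
  (2 * A) ^ R * 2 ^ d                  ≡⟨ trans (cong (_* 2 ^ d) (^-distribʳ-* 2 A R)) (*-assoc (2 ^ R) _ _) ⟩
  2 ^ R * (A ^ R * 2 ^ d)              ≤⟨ *-monoʳ-≤ (2 ^ R) (≤-trans g (*-monoˡ-≤ (2 ^ (d * R)) (m≤m+n C C′))) ⟩
  2 ^ R * ((C + C′) * 2 ^ (d * R))     ≡⟨ sym (*-assoc (2 ^ R) _ _) ⟩
  2 ^ R * (C + C′) * 2 ^ (d * R)       ∎
  where open ≤-Reasoning

-- A larger `R` claims a smaller saving; the summands of the size are brought to a common `R` this
-- way.
Gap-refine : ∀ R t {C d A} → .{{_ : NonZero t}} → Gap R C d A → Gap (R * t) (C ^ t) d A
Gap-refine R t@(suc t′) {C} {d} {A} g = begin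
  A ^ (R * t) * 2 ^ d         ≤⟨ *-monoʳ-≤ (A ^ (R * t)) (^-monoʳ-≤ 2 (m≤m*n d t)) ⟩
  A ^ (R * t) * 2 ^ (d * t)   ≡⟨ cong₂ _*_ (sym (^-*-assoc A R t)) (sym (^-*-assoc 2 d t)) ⟩
  (A ^ R) ^ t * (2 ^ d) ^ t   ≡⟨ sym (^-distribʳ-* (A ^ R) (2 ^ d) t) ⟩
  (A ^ R * 2 ^ d) ^ t         ≤⟨ ^-monoˡ-≤ t g ⟩
  (C * 2 ^ (d * R)) ^ t       ≡⟨ ^-distribʳ-* C _ t ⟩
  C ^ t * (2 ^ (d * R)) ^ t   ≡⟨ cong (C ^ t *_) (trans (^-*-assoc 2 (d * R) t) (cong (2 ^_) (*-assoc d R t))) ⟩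
  C ^ t * 2 ^ (d * (R * t))   ∎
  where open ≤-Reasoning

-- Squaring the gap of `A` yields 2^d twice. One copy pays for the subexponential factor `E`, the
-- other remains as the gap, with `R` doubled.
Gap-* : ∀ R {C C′ d A E} → E ^ (R * 2) ≤ C′ * 2 ^ d → Gap R C d A → Gap (R * 2) (C ^ 2 * C′) d (E * A)
Gap-* R {C} {C′} {d} {A} {E} e g = *-cancelʳ-≤ _ _ (2 ^ d) {{m^n≢0 2 d}} (begin
  (E * A) ^ (R * 2) * 2 ^ d * 2 ^ d              ≡⟨ cong (λ z → z * 2 ^ d * 2 ^ d) (^-distribʳ-* E A (R * 2)) ⟩
  E ^ (R * 2) * A ^ (R * 2) * 2 ^ d * 2 ^ d      ≡⟨ cong (λ z → E ^ (R * 2) * z * 2 ^ d * 2 ^ d) (sym (^-*-assoc A R 2)) ⟩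
  E ^ (R * 2) * (A ^ R) ^ 2 * 2 ^ d * 2 ^ d      ≡⟨ shuffle (E ^ (R * 2)) (A ^ R) (2 ^ d) ⟩
  E ^ (R * 2) * ((A ^ R * 2 ^ d) * (A ^ R * 2 ^ d))  ≤⟨ *-mono-≤ e (*-mono-≤ g g) ⟩
  C′ * 2 ^ d * ((C * 2 ^ (d * R)) * (C * 2 ^ (d * R)))  ≡⟨ shuffle′ C′ C (2 ^ d) (2 ^ (d * R)) ⟩
  C ^ 2 * C′ * (2 ^ (d * R)) ^ 2 * 2 ^ d         ≡⟨ cong (λ z → C ^ 2 * C′ * z * 2 ^ d) (trans (^-*-assoc 2 (d * R) 2) (cong (2 ^_) (*-assoc d R 2))) ⟩
  C ^ 2 * C′ * 2 ^ (d * (R * 2)) * 2 ^ d         ∎)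
  where
  open ≤-Reasoning
  shuffle : ∀ e a x → e * (a * (a * 1)) * x * x ≡ e * ((a * x) * (a * x))
  shuffle = solve-∀
  shuffle′ : ∀ c′ c x y → c′ * x * ((c * y) * (c * y)) ≡ c * (c * 1) * c′ * (y * (y * 1)) * x
  shuffle′ = solve-∀

-- With Q = 4k(k+1), so that Q + 1 = (2k+1)², this says (1 + 1/Q)^k < 1 + 1/k.
entropy-gap : ∀ k₀ → let k = suc k₀ in
  (2 * k + 1) ^ (2 * k) < 2 ^ (2 * k) * ((1 + k) ^ (1 + k) * k ^ k₀)
entropy-gap k₀ = ≰⇒> λ Z≤X → <⇒≱ kQ<[1+k]x (*-cancelˡ-≤ (Q ^ k) {{m^n≢0 Q k}} (begin
    Q ^ k * ((1 + k) * x)             ≡⟨ sym (*-assoc (Q ^ k) (1 + k) x) ⟩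
    Q ^ k * (1 + k) * x               ≡⟨ cong (_* x) (sym k*Z) ⟩
    k * Z * x                         ≤⟨ *-monoˡ-≤ x (*-monoʳ-≤ k Z≤X) ⟩
    k * X * x                         ≡⟨ cong (λ z → k * z * x) X≡ ⟩
    k * (1 + Q) ^ k * x               ≡⟨ *-assoc k ((1 + Q) ^ k) x ⟩
    k * ((1 + Q) ^ k * x)             ≤⟨ *-monoʳ-≤ k (bernoulli-upper k x (k+x k)) ⟩
    k * (Q ^ k * Q)                   ≡⟨ swap k (Q ^ k) Q ⟩
    Q ^ k * (k * Q)                   ∎))
  where
  open ≤-Reasoning
  k = suc k₀
  Q = 4 * (k * (1 + k))
  -- `x` is Q - k, so `bernoulli-upper` gives (1 + 1/Q)^k ≤ Q/x, and Q/x < (k + 1)/k is a comparison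
  -- of polynomials.
  x = 4 * (k * k) + 3 * k
  X = (2 * k + 1) ^ (2 * k)
  Z = 2 ^ (2 * k) * ((1 + k) ^ (1 + k) * k ^ k₀)
  swap : ∀ a b c → a * (b * c) ≡ b * (a * c)
  swap = solve-∀
  k+x : ∀ k → k + (4 * (k * k) + 3 * k) ≡ 4 * (k * (1 + k))
  k+x = solve-∀
  X≡ : X ≡ (1 + Q) ^ k
  X≡ = trans (sym (^-*-assoc (2 * k + 1) 2 k)) (cong (_^ k) (square k))
    where
    square : ∀ k → (2 * k + 1) * ((2 * k + 1) * 1) ≡ 1 + 4 * (k * (1 + k))
    square = solve-∀
  k*Z : k * Z ≡ Q ^ k * (1 + k)
  k*Z = begin-equality
    k * (2 ^ (2 * k) * ((1 + k) * (1 + k) ^ k * k ^ k₀))   ≡⟨ arrange k (2 ^ (2 * k)) (1 + k) ((1 + k) ^ k) (k ^ k₀) ⟩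
    2 ^ (2 * k) * (k ^ k * (1 + k) ^ k) * (1 + k)          ≡⟨ cong (λ z → z * (k ^ k * (1 + k) ^ k) * (1 + k)) (sym (^-*-assoc 2 2 k)) ⟩
    4 ^ k * (k ^ k * (1 + k) ^ k) * (1 + k)                ≡⟨ cong (λ z → 4 ^ k * z * (1 + k)) (sym (^-distribʳ-* k (1 + k) k)) ⟩
    4 ^ k * (k * (1 + k)) ^ k * (1 + k)                    ≡⟨ cong (_* (1 + k)) (sym (^-distribʳ-* 4 (k * (1 + k)) k)) ⟩
    Q ^ k * (1 + k)                                        ∎
    where
    arrange : ∀ k t s a b → k * (t * (s * a * b)) ≡ t * (k * b * a) * s
    arrange = solve-∀
  kQ<[1+k]x : k * Q < (1 + k) * x
  kQ<[1+k]x = subst (k * Q <_) (expand k₀) (m<m+n (k * Q) {3 * (k * k) + 3 * k} (s≤s z≤n))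
    where
    expand : ∀ k₀ → suc k₀ * (4 * (suc k₀ * (1 + suc k₀))) + (3 * (suc k₀ * suc k₀) + 3 * suc k₀) ≡
             (1 + suc k₀) * (4 * (suc k₀ * suc k₀) + 3 * suc k₀)
    expand = solve-∀

-- The cube is cut into blocks of `K` coordinates, ones weighing k + 1 and zeros k. `X₀` is the
-- total weight of a block and `Y₀` the weight of a block with k + 1 ones and k - 1 zeros;
-- `entropy-gap` says that their ratio is below 2^K.
module Layers (k₀ : ℕ) where
  k K X₀ Y₀ : ℕ
  k  = suc k₀
  K  = 2 * k
  X₀ = (2 * k + 1) ^ K
  Y₀ = (1 + k) ^ (1 + k) * k ^ k₀

  X₀≢0 : NonZero X₀
  X₀≢0 = m^n≢0 (2 * k + 1) K

  Rₗ Cₗ : ℕ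
  Rₗ = X₀ * K
  Cₗ = 2 ^ K * X₀ ^ Rₗ

  -- Each of the `m` blocks contributes a ratio X₀/Y₀ < 2^K. The power `X₀` turns this into a saving
  -- of 2^m, and the further power `K` into one of 2^d, up to 2^K for the incomplete block; hence
  -- `Rₗ` and `Cₗ`.
  outer-gap : ∀ d A → let m = d / K in let r = d % K in
    A * ((1 + k) ^ ((1 + k) * m) * k ^ (k₀ * m + r)) ≤ (2 * k + 1) ^ d → Gap Rₗ Cₗ d A
  outer-gap d A h = begin
    A ^ (X₀ * K) * 2 ^ d                          ≤⟨ *-mono-≤ (≤-reflexive (sym (^-*-assoc A X₀ K))) (≤-trans (^-monoʳ-≤ 2 d≤) (≤-reflexive (trans (^-distribˡ-+-* 2 K (m * K)) (cong (2 ^ K *_) (sym (^-*-assoc 2 m K)))))) ⟩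
    (A ^ X₀) ^ K * (2 ^ K * (2 ^ m) ^ K)          ≡⟨ swap ((A ^ X₀) ^ K) (2 ^ K) ((2 ^ m) ^ K) ⟩
    2 ^ K * ((A ^ X₀) ^ K * (2 ^ m) ^ K)          ≡⟨ cong (2 ^ K *_) (sym (^-distribʳ-* (A ^ X₀) (2 ^ m) K)) ⟩
    2 ^ K * (A ^ X₀ * 2 ^ m) ^ K                  ≤⟨ *-monoʳ-≤ (2 ^ K) (^-monoˡ-≤ K gap) ⟩
    2 ^ K * (X₀ ^ X₀ * 2 ^ (d * X₀)) ^ K          ≡⟨ cong (2 ^ K *_) (^-distribʳ-* (X₀ ^ X₀) _ K) ⟩
    2 ^ K * ((X₀ ^ X₀) ^ K * (2 ^ (d * X₀)) ^ K)  ≡⟨ sym (*-assoc (2 ^ K) _ _) ⟩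
    2 ^ K * (X₀ ^ X₀) ^ K * (2 ^ (d * X₀)) ^ K    ≡⟨ cong₂ (λ x y → 2 ^ K * x * y) (^-*-assoc X₀ X₀ K) (trans (^-*-assoc 2 (d * X₀) K) (cong (2 ^_) (*-assoc d X₀ K))) ⟩
    Cₗ * 2 ^ (d * Rₗ)                             ∎
    where
    open ≤-Reasoning
    m = d / K
    r = d % K
    Z = 2 ^ K * Y₀
    swap : ∀ a b c → a * (b * c) ≡ b * (a * c)
    swap = solve-∀
    d≡ : d ≡ r + m * K
    d≡ = m≡m%n+[m/n]*n d K
    d≤ : d ≤ K + m * K
    d≤ = subst (_≤ K + m * K) (sym d≡) (+-monoˡ-≤ (m * K) (<⇒≤ (m%n<n d K)))
    mK≤d : m * K ≤ d
    mK≤d = subst (m * K ≤_) (sym d≡) (m≤n+m _ r)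
    weight≡ : (1 + k) ^ ((1 + k) * m) * k ^ (k₀ * m + r) ≡ Y₀ ^ m * k ^ r
    weight≡ = begin-equality
      (1 + k) ^ ((1 + k) * m) * k ^ (k₀ * m + r)         ≡⟨ cong₂ _*_ (sym (^-*-assoc (1 + k) (1 + k) m)) (trans (^-distribˡ-+-* k (k₀ * m) r) (cong (_* k ^ r) (sym (^-*-assoc k k₀ m)))) ⟩
      ((1 + k) ^ (1 + k)) ^ m * ((k ^ k₀) ^ m * k ^ r)   ≡⟨ sym (*-assoc (((1 + k) ^ (1 + k)) ^ m) _ _) ⟩
      ((1 + k) ^ (1 + k)) ^ m * (k ^ k₀) ^ m * k ^ r     ≡⟨ cong (_* k ^ r) (sym (^-distribʳ-* ((1 + k) ^ (1 + k)) (k ^ k₀) m)) ⟩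
      Y₀ ^ m * k ^ r                                     ∎
    bound : A * Y₀ ^ m ≤ X₀ * X₀ ^ m
    bound = begin
      A * Y₀ ^ m                                      ≤⟨ m≤m*n′ _ (m^n>0 k r) ⟩
      A * Y₀ ^ m * k ^ r                              ≡⟨ trans (*-assoc A _ _) (cong (A *_) (sym weight≡)) ⟩
      A * ((1 + k) ^ ((1 + k) * m) * k ^ (k₀ * m + r))  ≤⟨ h ⟩
      (2 * k + 1) ^ d                                 ≤⟨ ^-monoʳ-≤ (2 * k + 1) d≤ ⟩
      (2 * k + 1) ^ (K + m * K)                       ≡⟨ trans (^-distribˡ-+-* (2 * k + 1) K (m * K)) (cong (λ e → X₀ * (2 * k + 1) ^ e) (*-comm m K)) ⟩
      X₀ * (2 * k + 1) ^ (K * m)                      ≡⟨ cong (X₀ *_) (sym (^-*-assoc (2 * k + 1) K m)) ⟩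
      X₀ * X₀ ^ m                                     ∎
    -- By `bound`, A is at most X₀ (X₀/Y₀)^m. With X₀ < Z = 2^K · Y₀, `doubling` gives 2 · X₀^X₀ ≤
    -- Z^X₀, which is the spare factor 2 of each block.
    gap : A ^ X₀ * 2 ^ m ≤ X₀ ^ X₀ * 2 ^ (d * X₀)
    gap = *-cancelʳ-≤ _ _ ((Z ^ m) ^ X₀) {{m^n≢0 (Z ^ m) X₀ {{m^n≢0 Z m {{Z≢0}}}}}} (begin
      A ^ X₀ * 2 ^ m * (Z ^ m) ^ X₀                              ≡⟨ cong (λ z → A ^ X₀ * 2 ^ m * z ^ X₀) (trans (^-distribʳ-* (2 ^ K) Y₀ m) (*-comm _ (Y₀ ^ m))) ⟩
      A ^ X₀ * 2 ^ m * (Y₀ ^ m * (2 ^ K) ^ m) ^ X₀               ≡⟨ cong (A ^ X₀ * 2 ^ m *_) (^-distribʳ-* (Y₀ ^ m) _ X₀) ⟩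
      A ^ X₀ * 2 ^ m * ((Y₀ ^ m) ^ X₀ * ((2 ^ K) ^ m) ^ X₀)      ≡⟨ arrange (A ^ X₀) (2 ^ m) ((Y₀ ^ m) ^ X₀) (((2 ^ K) ^ m) ^ X₀) ⟩
      (A ^ X₀ * (Y₀ ^ m) ^ X₀) * (2 ^ m * ((2 ^ K) ^ m) ^ X₀)    ≡⟨ cong (_* (2 ^ m * ((2 ^ K) ^ m) ^ X₀)) (sym (^-distribʳ-* A (Y₀ ^ m) X₀)) ⟩
      (A * Y₀ ^ m) ^ X₀ * (2 ^ m * ((2 ^ K) ^ m) ^ X₀)           ≤⟨ *-monoˡ-≤ _ (^-monoˡ-≤ X₀ bound) ⟩
      (X₀ * X₀ ^ m) ^ X₀ * (2 ^ m * ((2 ^ K) ^ m) ^ X₀)          ≡⟨ cong (_* (2 ^ m * ((2 ^ K) ^ m) ^ X₀)) (trans (^-distribʳ-* X₀ (X₀ ^ m) X₀) (cong (X₀ ^ X₀ *_) (^-swap X₀ m X₀))) ⟩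
      X₀ ^ X₀ * (X₀ ^ X₀) ^ m * (2 ^ m * ((2 ^ K) ^ m) ^ X₀)     ≡⟨ arrange′ (X₀ ^ X₀) ((X₀ ^ X₀) ^ m) (2 ^ m) (((2 ^ K) ^ m) ^ X₀) ⟩
      X₀ ^ X₀ * ((2 ^ K) ^ m) ^ X₀ * (2 ^ m * (X₀ ^ X₀) ^ m)     ≡⟨ cong₂ (λ x y → X₀ ^ X₀ * x * y) powers (sym (^-distribʳ-* 2 (X₀ ^ X₀) m)) ⟩
      X₀ ^ X₀ * 2 ^ (m * K * X₀) * (2 * X₀ ^ X₀) ^ m             ≤⟨ *-mono-≤ (*-monoʳ-≤ (X₀ ^ X₀) (^-monoʳ-≤ 2 (*-monoˡ-≤ X₀ mK≤d))) (^-monoˡ-≤ m (doubling X₀ {{X₀≢0}} (entropy-gap k₀))) ⟩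
      X₀ ^ X₀ * 2 ^ (d * X₀) * (Z ^ X₀) ^ m                      ≡⟨ cong (X₀ ^ X₀ * 2 ^ (d * X₀) *_) (^-swap Z X₀ m) ⟩
      X₀ ^ X₀ * 2 ^ (d * X₀) * (Z ^ m) ^ X₀                      ∎)
      where
      Z≢0 : NonZero Z
      Z≢0 = >-nonZero (≤-<-trans z≤n (entropy-gap k₀))
      arrange : ∀ a b c d → a * b * (c * d) ≡ (a * c) * (b * d)
      arrange = solve-∀
      arrange′ : ∀ a b c d → a * b * (c * d) ≡ a * d * (c * b)
      arrange′ = solve-∀
      powers : ((2 ^ K) ^ m) ^ X₀ ≡ 2 ^ (m * K * X₀)
      powers = trans (cong (_^ X₀) (trans (^-*-assoc 2 K m) (cong (2 ^_) (*-comm K m)))) (^-*-assoc 2 (m * K) X₀)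

-- Size and time in terms of the dimension

polynomial≤exponential′ : ∀ c e d → .{{_ : NonZero e}} → (c * suc d) ^ e ≤ c ^ e * e ^ e * 2 ^ d
polynomial≤exponential′ c e d = begin
  (c * suc d) ^ e           ≡⟨ ^-distribʳ-* c (suc d) e ⟩
  c ^ e * suc d ^ e         ≤⟨ *-monoʳ-≤ (c ^ e) (polynomial≤exponential e d) ⟩
  c ^ e * (e ^ e * 2 ^ d)   ≡⟨ sym (*-assoc (c ^ e) (e ^ e) (2 ^ d)) ⟩
  c ^ e * e ^ e * 2 ^ d     ∎
  where open ≤-Reasoning

∈⇒1≤length : ∀ {A : Set} {x : A} {xs} → x ∈ˡ xs → 1 ≤ length xs
∈⇒1≤length (here _)  = s≤s z≤n
∈⇒1≤length (there _) = s≤s z≤n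

size-bound : ∀ {d} (T Fs : List (Vec Bool d)) →
             Layout.size T Fs ≤ 7 * suc d * (length T + length Fs + 1)
size-bound {d} T Fs = begin
  2 + dead d + length (trie d (dead (suc d)) T) + (N * suc d + 1)
    ≤⟨ +-monoˡ-≤ (N * suc d + 1) (+-mono-≤ (≤-reflexive (cong (2 +_) (dead≡ d))) (length-trie d (dead (suc d)) T)) ⟩
  2 + (4 + 2 * d) + 2 * (d * t) + (N * suc d + 1)
    ≤⟨ m≤m+n _ (5 * d + 7 * t + 5 * (d * t) + 6 * (N * suc d)) ⟩
  2 + (4 + 2 * d) + 2 * (d * t) + (N * suc d + 1) + (5 * d + 7 * t + 5 * (d * t) + 6 * (N * suc d))
    ≡⟨ collect d t N ⟩
  7 * suc d * (t + N + 1) ∎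
  where
  open ≤-Reasoning
  t = length T
  N = length Fs
  collect : ∀ d t N → 2 + (4 + 2 * d) + 2 * (d * t) + (N * suc d + 1) +
            (5 * d + 7 * t + 5 * (d * t) + 6 * (N * suc d)) ≡ 7 * suc d * (t + N + 1)
  collect = solve-∀

-- Choice of the parameters

module Parameters (j : ℕ) (j≢0 : NonZero j) where
  -- Then `K` is 16j² + 2, so that m = d / K satisfies the hypothesis 16j² · m ≤ d of
  -- `light-exponent`.
  open Layers (8 * (j * j)) public

  radius threshold : ℕ → ℕ
  radius d    = 2 * (d / K)
  threshold d = (1 + k) * (d / K)

  mK≤d : ∀ d → d / K * K ≤ d
  mK≤d d = subst (d / K * K ≤_) (sym (m≡m%n+[m/n]*n d K)) (m≤n+m _ (d % K))

  2threshold≤ : ∀ d → 2 * threshold d ≤ d + radius d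
  2threshold≤ d = begin
    2 * ((1 + k) * (d / K))          ≡⟨ expand k (d / K) ⟩
    d / K * (2 * k) + 2 * (d / K)    ≤⟨ +-monoˡ-≤ (2 * (d / K)) (mK≤d d) ⟩
    d + radius d                     ∎
    where
    open ≤-Reasoning
    expand : ∀ k m → 2 * ((1 + k) * m) ≡ m * (2 * k) + 2 * m
    expand = solve-∀

  additions : ∀ d → List (Vec Bool d)
  additions d = light (radius d)

  N : ℕ → ℕ
  N d = length (additions d)

  1≤N : ∀ d → 1 ≤ N d
  1≤N d = ∈⇒1≤length {x = ∅ {d}} {additions d} (∈-light {s = radius d} {∅ {d}} (subst (_≤ radius d) (sym (ones-∅ d)) z≤n))

  N≤2^d : ∀ d → N d ≤ 2 ^ d
  N≤2^d d = ≤-trans (length-filter (λ F → ones F ≤? radius d) (cube d)) (≤-reflexive (length-cube d))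

  N^j≤2^d : ∀ d → N d ^ j ≤ 2 ^ d
  N^j≤2^d d = light-exponent j d (d / K) (d ∸ radius d) (N d) {{j≢0}} l≡ 16jjm≤
    (length-light (radius d) (4 * j) (d ∸ radius d) l≡ {{m*n≢0 4 j {{_}} {{j≢0}}}})
    where
    open ≤-Reasoning
    16jjm≤ : 16 * (j * j) * (d / K) ≤ d
    16jjm≤ = begin
      16 * (j * j) * (d / K)                    ≤⟨ m≤m+n _ (2 * (d / K)) ⟩
      16 * (j * j) * (d / K) + 2 * (d / K)      ≡⟨ expand (j * j) (d / K) ⟩
      d / K * (2 * (1 + 8 * (j * j)))           ≤⟨ mK≤d d ⟩
      d                                         ∎
      where
      expand : ∀ x m → 16 * x * m + 2 * m ≡ m * (2 * (1 + 8 * x))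
      expand = solve-∀
    l≡ : d ∸ radius d + radius d ≡ d
    l≡ = m∸n+n≡m (begin
      2 * (d / K)      ≤⟨ *-monoˡ-≤ (d / K) (m≤m*n 2 k) ⟩
      K * (d / K)      ≡⟨ *-comm K (d / K) ⟩
      d / K * K        ≤⟨ mK≤d d ⟩
      d                ∎)

  N^≤2^d : ∀ d {e} → e ≤ j → N d ^ e ≤ 2 ^ d
  N^≤2^d d e≤j = ≤-trans (^-monoʳ-≤ (N d) {{>-nonZero (1≤N d)}} e≤j) (N^j≤2^d d)

  module Index {n d} (S : Vec (Vec Bool d) n) where
    open Stored (threshold d) (radius d) S public
    open Counts (threshold d) (radius d) S
    open Layout stored (additions d) public using (structure; size)

    X₁ X₂ : ℕ
    X₁ = length heavyQueries
    X₂ = length lightQueries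

    private
      below : ℕ
      below = 8 * (j * j) * (d / K) + d % K

      below≡ : threshold d + below ≡ d
      below≡ = trans (expand (8 * (j * j)) (d / K) (d % K)) (sym (m≡m%n+[m/n]*n d K))
        where
        expand : ∀ x m r → (2 + x) * m + (x * m + r) ≡ r + m * (2 * suc x)
        expand = solve-∀

      w : ℕ
      w = (1 + k) ^ threshold d * k ^ below

      k+k : ∀ k → 1 + k + k ≡ 2 * k + 1
      k+k = solve-∀

    heavy-gap : Gap Rₗ Cₗ d X₁
    heavy-gap = outer-gap d X₁ (subst (λ b → X₁ * w ≤ b ^ d) (k+k k)
      (length-heavy (1 + k) k below (n≤1+n k) below≡))

    light-gap : Gap Rₗ Cₗ d X₂
    light-gap = outer-gap d X₂ (subst (λ b → X₂ * w ≤ b ^ d) (trans (+-comm k (1 + k)) (k+k k))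
      (length-lightQueries (1 + k) k below (n≤1+n k) below≡))

    length-stored : length stored ≡ X₁ + (X₂ + n * N d)
    length-stored = trans (length-++ heavyQueries)
      (cong (X₁ +_) (trans (length-++ lightQueries) (cong (X₂ +_) length-near)))

    -- The parts are separated by the origin of their saving: layers save by `outer-gap`, near
    -- queries by c > 1. The tape and the constant term are at most n · N each, so 21 is three times
    -- 7.
    size-split : 1 ≤ n → size ≤ 7 * suc d * X₁ + 7 * suc d * X₂ + 21 * suc d * (n * N d)
    size-split 1≤n = begin
      size                                                 ≤⟨ size-bound stored (additions d) ⟩
      7 * suc d * (length stored + N d + 1)                ≡⟨ cong (λ l → 7 * suc d * (l + N d + 1)) length-stored ⟩
      7 * suc d * (X₁ + (X₂ + n * N d) + N d + 1)          ≤⟨ *-monoʳ-≤ (7 * suc d) (+-mono-≤ (+-monoʳ-≤ (X₁ + (X₂ + n * N d)) N≤) 1≤) ⟩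
      7 * suc d * (X₁ + (X₂ + n * N d) + n * N d + n * N d)  ≡⟨ expand (suc d) X₁ X₂ (n * N d) ⟩
      7 * suc d * X₁ + 7 * suc d * X₂ + 21 * suc d * (n * N d)  ∎
      where
      open ≤-Reasoning
      N≤ : N d ≤ n * N d
      N≤ = ≤-trans (≤-reflexive (sym (*-identityˡ (N d)))) (*-monoˡ-≤ (N d) 1≤n)
      1≤ : 1 ≤ n * N d
      1≤ = *-mono-≤ 1≤n (1≤N d)
      expand : ∀ e x y z → 7 * e * (x + (y + z) + z + z) ≡ 7 * e * x + 7 * e * y + 21 * e * z
      expand = solve-∀

    -- Only the word size depends on this, so every list may be bounded by a full cube; 36 collects
    -- the coefficients and is rounded up to 2^7.
    size+d< : ∀ {l} → 1 ≤ n → n ≤ 2 ^ l → size + d < 2 ^ (7 + 2 * d + l)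
    size+d< {l} 1≤n n≤ = begin-strict
      size + d                                                  ≤⟨ +-mono-≤ (size-split 1≤n) d≤ ⟩
      7 * suc d * X₁ + 7 * suc d * X₂ + 21 * suc d * (n * N d) + suc d * (n * N d)
        ≤⟨ +-mono-≤ (+-monoˡ-≤ _ (+-mono-≤ (outer X₁≤) (outer X₂≤))) ≤-refl ⟩
      7 * suc d * (n * D) + 7 * suc d * (n * D) + 21 * suc d * (n * N d) + suc d * (n * N d)
        ≤⟨ +-mono-≤ (+-monoʳ-≤ (7 * suc d * (n * D) + 7 * suc d * (n * D)) (*-monoʳ-≤ (21 * suc d) nN≤)) (*-monoʳ-≤ (suc d) nN≤) ⟩
      7 * suc d * (n * D) + 7 * suc d * (n * D) + 21 * suc d * (n * D) + suc d * (n * D)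
        ≡⟨ collect (suc d) (n * D) ⟩
      36 * (suc d * (n * D))                                    <⟨ *-monoˡ-< (suc d * (n * D)) {{>-nonZero (*-mono-≤ (s≤s (z≤n {d})) (*-mono-≤ 1≤n (m^n>0 2 d)))}} {36} {128} (≤ᵇ⇒≤ 37 128 _) ⟩
      128 * (suc d * (n * D))                                   ≤⟨ *-monoʳ-≤ 128 (*-mono-≤ (n<2^n d) (*-monoˡ-≤ D n≤)) ⟩
      128 * (D * (2 ^ l * D))                                   ≡⟨ arrange D (2 ^ l) ⟩
      128 * (D * (D * 1)) * 2 ^ l                               ≡⟨ cong (λ x → 128 * x * 2 ^ l) (trans (^-*-assoc 2 d 2) (cong (2 ^_) (*-comm d 2))) ⟩
      2 ^ 7 * 2 ^ (2 * d) * 2 ^ l                               ≡⟨ sym (trans (^-distribˡ-+-* 2 (7 + 2 * d) l) (cong (_* 2 ^ l) (^-distribˡ-+-* 2 7 (2 * d)))) ⟩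
      2 ^ (7 + 2 * d + l)                                       ∎
      where
      open ≤-Reasoning
      D = 2 ^ d
      d≤ : d ≤ suc d * (n * N d)
      d≤ = ≤-trans (n≤1+n d) (m≤m*n′ (suc d) (*-mono-≤ 1≤n (1≤N d)))
      nN≤ : n * N d ≤ n * D
      nN≤ = *-monoʳ-≤ n (N≤2^d d)
      X₁≤ : X₁ ≤ D
      X₁≤ = ≤-trans (length-filter heavyQuery? (cube d)) (≤-reflexive (length-cube d))
      X₂≤ : X₂ ≤ D
      X₂≤ = ≤-trans (length-filter lightQuery? (cube d)) (≤-reflexive (length-cube d))
      outer : ∀ {X} → X ≤ D → 7 * suc d * X ≤ 7 * suc d * (n * D)
      outer X≤ = *-monoʳ-≤ (7 * suc d) (≤-trans X≤ (≤-trans (≤-reflexive (sym (*-identityˡ D))) (*-monoˡ-≤ D 1≤n)))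
      collect : ∀ e z → 7 * e * z + 7 * e * z + 21 * e * z + e * z ≡ 36 * (e * z)
      collect = solve-∀
      arrange : ∀ D l → 128 * (D * (l * D)) ≡ 128 * (D * (D * 1)) * l
      arrange = solve-∀

  Rₗ≢0 : NonZero Rₗ
  Rₗ≢0 = m*n≢0 X₀ K {{X₀≢0}}

  time : ℕ → ℕ
  time d = 8 + 7 * (N d * suc d)

  -- The claim is proved squared: of the two factors 2^d one absorbs the polynomial in `d`, the
  -- other bounds N^(2J), for which `J * 2 ≤ j` is required.
  time-bound : ∀ J d → .{{_ : NonZero J}} → J * 2 ≤ j → time d ^ J ≤ 15 ^ (J * 2) * (J * 2) ^ (J * 2) * 2 ^ d
  time-bound J@(suc _) d 2J≤j = ^-cancelˡ-≤ 2 (begin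
    (time d ^ J) ^ 2                           ≡⟨ ^-*-assoc (time d) J 2 ⟩
    time d ^ J₂                                ≤⟨ ^-monoˡ-≤ J₂ time≤ ⟩
    (15 * suc d * N d) ^ J₂                    ≡⟨ ^-distribʳ-* (15 * suc d) (N d) J₂ ⟩
    (15 * suc d) ^ J₂ * N d ^ J₂               ≤⟨ *-mono-≤ (polynomial≤exponential′ 15 J₂ d) (N^≤2^d d 2J≤j) ⟩
    c * 2 ^ d * 2 ^ d                          ≤⟨ *-monoˡ-≤ (2 ^ d) (*-monoˡ-≤ (2 ^ d) (m≤m*n′ c 1≤c)) ⟩
    c * c * 2 ^ d * 2 ^ d                      ≡⟨ shuffle c (2 ^ d) ⟩
    (c * 2 ^ d) ^ 2                            ∎)
    where
    open ≤-Reasoning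
    J₂ = J * 2
    c  = 15 ^ J₂ * J₂ ^ J₂
    1≤c : 1 ≤ c
    1≤c = *-mono-≤ (m^n>0 15 J₂) (m^n>0 J₂ J₂)
    shuffle : ∀ c x → c * c * x * x ≡ c * x * (c * x * 1)
    shuffle = solve-∀
    time≤ : time d ≤ 15 * suc d * N d
    time≤ = begin
      8 + 7 * (N d * suc d)              ≤⟨ +-monoˡ-≤ _ (*-monoʳ-≤ 8 (*-mono-≤ (1≤N d) (s≤s (z≤n {d})))) ⟩
      8 * (N d * suc d) + 7 * (N d * suc d)  ≡⟨ collect (N d) (suc d) ⟩
      15 * suc d * N d                   ∎
      where
      collect : ∀ x y → 8 * (x * y) + 7 * (x * y) ≡ 15 * y * x
      collect = solve-∀

  module Space (p q : ℕ) (q<p : q < p) (4p≤j : 4 * p ≤ j) where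
    private
      instance
        p≢0 : NonZero p
        p≢0 = >-nonZero (≤-<-trans z≤n q<p)
        4p≢0 : NonZero (4 * p)
        4p≢0 = m*n≢0 4 p
        2Rₗ≢0 : NonZero (Rₗ * 2)
        2Rₗ≢0 = m*n≢0 Rₗ 2 {{Rₗ≢0}}

    Cₙ Cₒ : ℕ
    Cₙ = 21 ^ (4 * p) * (4 * p) ^ (4 * p) * 2 ^ (4 * q)
    Cₒ = Cₗ ^ 2 * (7 ^ (Rₗ * 2) * (Rₗ * 2) ^ (Rₗ * 2))

    -- The hypothesis is n ≤ 2^((d + 1) q/p). For the exponent 4p, the power of n costs 4q (d + 1),
    -- while the polynomial factor, the power of N and the gap itself cost d each. As 4q + 3 ≤ 4p,
    -- there is room for all of them; this is where c > 1 enters.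
    near-gap : ∀ n d → n ^ p ≤ 2 ^ (suc d * q) → Gap (4 * p) Cₙ d (21 * suc d * (n * N d))
    near-gap n d n≤ = begin
      (E * (n * N d)) ^ P * 2 ^ d                     ≡⟨ cong (_* 2 ^ d) (trans (^-distribʳ-* E (n * N d) P) (cong (E ^ P *_) (^-distribʳ-* n (N d) P))) ⟩
      E ^ P * (n ^ P * N d ^ P) * 2 ^ d               ≤⟨ *-monoˡ-≤ (2 ^ d) (*-mono-≤ (polynomial≤exponential′ 21 P d) (*-mono-≤ n^P≤ (N^≤2^d d 4p≤j))) ⟩
      c * 2 ^ d * (2 ^ (suc d * (4 * q)) * 2 ^ d) * 2 ^ d  ≡⟨ arrange c (2 ^ d) (2 ^ (suc d * (4 * q))) ⟩
      c * (2 ^ d * (2 ^ d * (2 ^ d * 2 ^ (suc d * (4 * q)))))  ≡⟨ cong (c *_) (sym (trans (^-distribˡ-+-* 2 d _) (cong (2 ^ d *_) (trans (^-distribˡ-+-* 2 d _) (cong (2 ^ d *_) (^-distribˡ-+-* 2 d _)))))) ⟩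
      c * 2 ^ (d + (d + (d + suc d * (4 * q))))       ≤⟨ *-monoʳ-≤ c (^-monoʳ-≤ 2 exponent) ⟩
      c * 2 ^ (4 * q + d * P)                         ≡⟨ trans (cong (c *_) (^-distribˡ-+-* 2 (4 * q) (d * P))) (sym (*-assoc c _ _)) ⟩
      Cₙ * 2 ^ (d * P)                                ∎
      where
      open ≤-Reasoning
      E = 21 * suc d
      P = 4 * p
      c = 21 ^ P * P ^ P
      arrange : ∀ c x y → c * x * (y * x) * x ≡ c * (x * (x * (x * y)))
      arrange = solve-∀
      n^P≤ : n ^ P ≤ 2 ^ (suc d * (4 * q))
      n^P≤ = begin
        n ^ (4 * p)                ≡⟨ trans (cong (n ^_) (*-comm 4 p)) (sym (^-*-assoc n p 4)) ⟩
        (n ^ p) ^ 4                ≤⟨ ^-monoˡ-≤ 4 n≤ ⟩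
        (2 ^ (suc d * q)) ^ 4      ≡⟨ ^-*-assoc 2 (suc d * q) 4 ⟩
        2 ^ (suc d * q * 4)        ≡⟨ cong (2 ^_) (trans (*-assoc (suc d) q 4) (cong (suc d *_) (*-comm q 4))) ⟩
        2 ^ (suc d * (4 * q))      ∎
      exponent : d + (d + (d + suc d * (4 * q))) ≤ 4 * q + d * P
      exponent = begin
        d + (d + (d + suc d * (4 * q)))                ≤⟨ m≤n+m _ d ⟩
        d + (d + (d + (d + suc d * (4 * q))))          ≡⟨ expand d q ⟩
        4 * q + d * (4 * suc q)                        ≤⟨ +-monoʳ-≤ (4 * q) (*-monoʳ-≤ d (*-monoʳ-≤ 4 q<p)) ⟩
        4 * q + d * P                                  ∎
        where
        expand : ∀ d q → d + (d + (d + (d + suc d * (4 * q)))) ≡ 4 * q + d * (4 * suc q)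
        expand = solve-∀

    -- A common multiple of the exponent of the layers, doubled by `Gap-*`, and that of the near
    -- queries.
    R : ℕ
    R = Rₗ * 2 * (4 * p)

    R≢0 : NonZero R
    R≢0 = m*n≢0 (Rₗ * 2) (4 * p)

    C : ℕ
    C = 2 ^ R * (2 ^ R * (Cₒ ^ (4 * p) + Cₒ ^ (4 * p)) + Cₙ ^ (Rₗ * 2))

    size-gap : ∀ {n d} (S : Vec (Vec Bool d) n) → 1 ≤ n → n ^ p ≤ 2 ^ (suc d * q) →
               Gap R C d (Index.size S)
    size-gap {n} {d} S 1≤n n≤ = ≤-trans (*-monoˡ-≤ (2 ^ d) (^-monoˡ-≤ R (size-split 1≤n)))
      (Gap-+ R {2 ^ R * (Cₒ ^ (4 * p) + Cₒ ^ (4 * p))} {Cₙ ^ (Rₗ * 2)} {d} {7 * suc d * X₁ + 7 * suc d * X₂}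
        (Gap-+ R {Cₒ ^ (4 * p)} {Cₒ ^ (4 * p)} {d} {7 * suc d * X₁} (outer {X₁} heavy-gap) (outer {X₂} light-gap))
        near)
      where
      open Index S
      outer : ∀ {X} → Gap Rₗ Cₗ d X → Gap R (Cₒ ^ (4 * p)) d (7 * suc d * X)
      outer {X} g = Gap-refine (Rₗ * 2) (4 * p) {Cₒ} {d} {7 * suc d * X}
        (Gap-* Rₗ {Cₗ} {7 ^ (Rₗ * 2) * (Rₗ * 2) ^ (Rₗ * 2)} {d} {X} {7 * suc d} (polynomial≤exponential′ 7 (Rₗ * 2) d) g)
      near : Gap R (Cₙ ^ (Rₗ * 2)) d (21 * suc d * (n * N d))
      near = subst (λ r → Gap r (Cₙ ^ (Rₗ * 2)) d (21 * suc d * (n * N d))) (*-comm (4 * p) (Rₗ * 2))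
        (Gap-refine (4 * p) (Rₗ * 2) {Cₙ} {d} {21 * suc d * (n * N d)} (near-gap n d n≤))

-- Real exponents

n≤2^⌈log₂n⌉ : ∀ n → n ≤ 2 ^ ⌈log₂ n ⌉
n≤2^⌈log₂n⌉ = <-rec _ go
  where
  go : ∀ n → (∀ {m} → m < n → m ≤ 2 ^ ⌈log₂ m ⌉) → n ≤ 2 ^ ⌈log₂ n ⌉
  go zero             rec = z≤n
  go (suc zero)       rec = m^n>0 2 ⌈log₂ 1 ⌉
  go n@(suc (suc n₀)) rec = begin
    n                                  ≡⟨ sym (⌊n/2⌋+⌈n/2⌉≡n n) ⟩
    ⌊ n /2⌋ + ⌈ n /2⌉                  ≤⟨ +-mono-≤ (⌊n/2⌋≤⌈n/2⌉ n) (m≤m+n ⌈ n /2⌉ 0) ⟩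
    2 * ⌈ n /2⌉                        ≤⟨ *-monoʳ-≤ 2 (rec (⌈n/2⌉<n n₀)) ⟩
    2 * 2 ^ ⌈log₂ ⌈ n /2⌉ ⌉            ≡⟨ cong (λ l → 2 * 2 ^ l) (⌈log₂⌈n/2⌉⌉≡⌈log₂n⌉∸1 n) ⟩
    2 ^ suc (⌈log₂ n ⌉ ∸ 1)            ≡⟨ cong (2 ^_) (m+[n∸m]≡n {1} (⌈log₂⌉-mono-≤ {2} {n} (s≤s (s≤s z≤n)))) ⟩
    2 ^ ⌈log₂ n ⌉                      ∎
    where open ≤-Reasoning

^-cancelʳ-≤ : ∀ b {m n} → 1 < b → b ^ m ≤ b ^ n → m ≤ n
^-cancelʳ-≤ b {m} {n} 1<b h with m ≤? n
... | yes m≤n = m≤n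
... | no  m≰n = contradiction h (<⇒≱ (^-monoʳ-< b 1<b (≰⇒> m≰n)))

-- In quotients: A/B ≤ n^(j - i) ≤ n^(l - k). Keeping the two exponents apart avoids subtraction and
-- negative powers.
shift-exponents : ∀ {n} → 1 ≤ n → ∀ A B i j k l → j + k ≤ l + i → A * n ^ i ≤ B * n ^ j → A * n ^ k ≤ B * n ^ l
shift-exponents {n} 1≤n A B i j k l h a = *-cancelʳ-≤ _ _ (n ^ i) {{m^n≢0 n i}} (begin
  A * n ^ k * n ^ i      ≡⟨ swap A (n ^ k) (n ^ i) ⟩
  A * n ^ i * n ^ k      ≤⟨ *-monoˡ-≤ (n ^ k) a ⟩
  B * n ^ j * n ^ k      ≡⟨ trans (*-assoc B _ _) (cong (B *_) (sym (^-distribˡ-+-* n j k))) ⟩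
  B * n ^ (j + k)        ≤⟨ *-monoʳ-≤ B (^-monoʳ-≤ n h) ⟩
  B * n ^ (l + i)        ≡⟨ trans (cong (B *_) (^-distribˡ-+-* n l i)) (sym (*-assoc B _ _)) ⟩
  B * n ^ l * n ^ i      ∎)
  where
  open ≤-Reasoning
  instance
    n≢0 : NonZero n
    n≢0 = >-nonZero 1≤n
  swap : ∀ a b c → a * b * c ≡ a * c * b
  swap = solve-∀

raise-≤ : ∀ e {n A B i j} → A * n ^ i ≤ B * n ^ j → A ^ e * n ^ (i * e) ≤ B ^ e * n ^ (j * e)
raise-≤ e {n} {A} {B} {i} {j} h = begin
  A ^ e * n ^ (i * e)   ≡⟨ expand A i ⟩
  (A * n ^ i) ^ e       ≤⟨ ^-monoˡ-≤ e h ⟩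
  (B * n ^ j) ^ e       ≡⟨ sym (expand B j) ⟩
  B ^ e * n ^ (j * e)   ∎
  where
  open ≤-Reasoning
  expand : ∀ A i → A ^ e * n ^ (i * e) ≡ (A * n ^ i) ^ e
  expand A i = trans (cong (A ^ e *_) (sym (^-*-assoc n i e))) (sym (^-distribʳ-* A (n ^ i) e))

root-≤ : ∀ e {n A B i j} → .{{_ : NonZero e}} → A ^ e * n ^ (i * e) ≤ B ^ e * n ^ (j * e) → A * n ^ i ≤ B * n ^ j
root-≤ e {n} {A} {B} {i} {j} h = ^-cancelˡ-≤ e (begin
  (A * n ^ i) ^ e       ≡⟨ expand A i ⟩
  A ^ e * n ^ (i * e)   ≤⟨ h ⟩
  B ^ e * n ^ (j * e)   ≡⟨ sym (expand B j) ⟩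
  (B * n ^ j) ^ e       ∎)
  where
  open ≤-Reasoning
  expand : ∀ A i → (A * n ^ i) ^ e ≡ A ^ e * n ^ (i * e)
  expand A i = trans (^-distribʳ-* A (n ^ i) e) (cong (A ^ e *_) (^-*-assoc n i e))

pos neg : ℚ → ℕ
pos q = posPart (↥ q)
neg q = negPart (↥ q)

posPart-negPart : ∀ i → i ≡ ℤ.+ posPart i ℤ.- ℤ.+ negPart i
posPart-negPart (ℤ.+ a)    = sym (ℤP.+-identityʳ (ℤ.+ a))
posPart-negPart ℤ.-[1+ a ] = refl

posPart-negPart-* : ∀ i y → i ℤ.* ℤ.+ y ≡ ℤ.+ (posPart i * y) ℤ.- ℤ.+ (negPart i * y)
posPart-negPart-* i y = begin
  i ℤ.* ℤ.+ y                                            ≡⟨ cong (ℤ._* ℤ.+ y) (posPart-negPart i) ⟩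
  (ℤ.+ posPart i ℤ.- ℤ.+ negPart i) ℤ.* ℤ.+ y            ≡⟨ expand (ℤ.+ posPart i) (ℤ.+ negPart i) (ℤ.+ y) ⟩
  ℤ.+ posPart i ℤ.* ℤ.+ y ℤ.- ℤ.+ negPart i ℤ.* ℤ.+ y    ≡⟨ cong₂ ℤ._-_ (sym (ℤP.pos-* (posPart i) y)) (sym (ℤP.pos-* (negPart i) y)) ⟩
  ℤ.+ (posPart i * y) ℤ.- ℤ.+ (negPart i * y)            ∎
  where
  open ≡-Reasoning
  expand : ∀ p n y → (p ℤ.- n) ℤ.* y ≡ p ℤ.* y ℤ.- n ℤ.* y
  expand = ℤSolver.solve-∀

difference-< : ∀ a b c d → ℤ.+ a ℤ.- ℤ.+ b ℤ.< ℤ.+ c ℤ.- ℤ.+ d → a + d ≤ c + b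
difference-< a b c d h = ℤP.drop‿+≤+ (ℤP.<⇒≤ (subst₂ ℤ._<_ lhs rhs (ℤP.+-monoˡ-< (ℤ.+ b ℤ.+ ℤ.+ d) h)))
  where
  lhs : ℤ.+ a ℤ.- ℤ.+ b ℤ.+ (ℤ.+ b ℤ.+ ℤ.+ d) ≡ ℤ.+ (a + d)
  lhs = trans (cancel (ℤ.+ a) (ℤ.+ b) (ℤ.+ d)) (sym (ℤP.pos-+ a d))
    where
    cancel : ∀ a b d → a ℤ.- b ℤ.+ (b ℤ.+ d) ≡ a ℤ.+ d
    cancel = ℤSolver.solve-∀
  rhs : ℤ.+ c ℤ.- ℤ.+ d ℤ.+ (ℤ.+ b ℤ.+ ℤ.+ d) ≡ ℤ.+ (c + b)
  rhs = trans (cancel (ℤ.+ c) (ℤ.+ d) (ℤ.+ b)) (sym (ℤP.pos-+ c b))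
    where
    cancel : ∀ c d b → c ℤ.- d ℤ.+ (b ℤ.+ d) ≡ c ℤ.+ b
    cancel = ℤSolver.solve-∀

-- Cross-multiplication with signed numerators split into two parts, which is the form that
-- `shift-exponents` takes.
<⇒exponents : ∀ {p q} → p ℚ.< q → pos p * ↧ₙ q + neg q * ↧ₙ p ≤ pos q * ↧ₙ p + neg p * ↧ₙ q
<⇒exponents {p} {q} p<q = difference-< (pos p * ↧ₙ q) (neg p * ↧ₙ q) (pos q * ↧ₙ p) (neg q * ↧ₙ p)
  (subst₂ ℤ._<_ (posPart-negPart-* (↥ p) (↧ₙ q)) (posPart-negPart-* (↥ q) (↧ₙ p)) (ℚP.drop-*<* p<q))

1/suc : ℕ → ℚ
1/suc r = mkℚ (ℤ.+ 1) r (1-coprimeTo (suc r))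

<+1/suc⇒exponents : ∀ {p q} r → p ℚ.< q ℚ.+ 1/suc r →
  pos p * (↧ₙ q * suc r) + neg q * (suc r * ↧ₙ p) ≤ pos q * (suc r * ↧ₙ p) + ↧ₙ q * ↧ₙ p + neg p * (↧ₙ q * suc r)
<+1/suc⇒exponents {p@record{}} {q@record{}} r p< =
  difference-< (pos p * (↧ₙ q * suc r)) (neg p * (↧ₙ q * suc r))
               (pos q * (suc r * ↧ₙ p) + ↧ₙ q * ↧ₙ p) (neg q * (suc r * ↧ₙ p))
    (subst₂ ℤ._<_ (posPart-negPart-* (↥ p) (↧ₙ q * suc r)) rhs
      (ℚᵘP.drop-*<* (ℚᵘP.<-respʳ-≃ (ℚP.toℚᵘ-homo-+ q (1/suc r)) (ℚP.toℚᵘ-mono-< p<))))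
  where
  rhs : (↥ q ℤ.* ℤ.+ suc r ℤ.+ ℤ.+ 1 ℤ.* ↧ q) ℤ.* ↧ p ≡
        ℤ.+ (pos q * (suc r * ↧ₙ p) + ↧ₙ q * ↧ₙ p) ℤ.- ℤ.+ (neg q * (suc r * ↧ₙ p))
  rhs = begin
    (↥ q ℤ.* ℤ.+ suc r ℤ.+ ℤ.+ 1 ℤ.* ↧ q) ℤ.* ↧ p
      ≡⟨ expand (↥ q) (ℤ.+ suc r) (↧ q) (↧ p) ⟩
    ↥ q ℤ.* (ℤ.+ suc r ℤ.* ↧ p) ℤ.+ ↧ q ℤ.* ↧ p
      ≡⟨ cong₂ ℤ._+_ (trans (cong (↥ q ℤ.*_) (sym (ℤP.pos-* (suc r) (↧ₙ p)))) (posPart-negPart-* (↥ q) (suc r * ↧ₙ p))) (sym (ℤP.pos-* (↧ₙ q) (↧ₙ p))) ⟩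
    ℤ.+ (pos q * (suc r * ↧ₙ p)) ℤ.- ℤ.+ (neg q * (suc r * ↧ₙ p)) ℤ.+ ℤ.+ (↧ₙ q * ↧ₙ p)
      ≡⟨ move (ℤ.+ (pos q * (suc r * ↧ₙ p))) (ℤ.+ (neg q * (suc r * ↧ₙ p))) (ℤ.+ (↧ₙ q * ↧ₙ p)) ⟩
    ℤ.+ (pos q * (suc r * ↧ₙ p)) ℤ.+ ℤ.+ (↧ₙ q * ↧ₙ p) ℤ.- ℤ.+ (neg q * (suc r * ↧ₙ p))
      ≡⟨ cong (ℤ._- ℤ.+ (neg q * (suc r * ↧ₙ p))) (sym (ℤP.pos-+ (pos q * (suc r * ↧ₙ p)) _)) ⟩
    ℤ.+ (pos q * (suc r * ↧ₙ p) + ↧ₙ q * ↧ₙ p) ℤ.- ℤ.+ (neg q * (suc r * ↧ₙ p)) ∎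
    where
    open ≡-Reasoning
    expand : ∀ x r y z → (x ℤ.* r ℤ.+ ℤ.+ 1 ℤ.* y) ℤ.* z ≡ x ℤ.* (r ℤ.* z) ℤ.+ y ℤ.* z
    expand = ℤSolver.solve-∀
    move : ∀ a b c → a ℤ.- b ℤ.+ c ≡ a ℤ.+ c ℤ.- b
    move = ℤSolver.solve-∀

-- The witness `u` of the hypothesis lies above `c` and `q` below, so q < u by `disjoint`, and n^q ≤
-- n^u < m.
power-below : ∀ {c n m q} → 1 ≤ n → Lower c q → neg q ≡ 0 → [ n ^ c ]< m → n ^ pos q ≤ m ^ ↧ₙ q
power-below {c} {n} {m} {q} 1≤n lower neg≡0 (u , upper , h) =
  subst₂ _≤_ (*-identityˡ _) (*-identityʳ _)
    (root-≤ (↧ₙ u) {n} {1} {m ^ ↧ₙ q} {pos q} {0} (subst (λ x → x * n ^ (pos q * ↧ₙ u) ≤ (m ^ ↧ₙ q) ^ ↧ₙ u * 1) (sym (^-zeroˡ (↧ₙ u)))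
      (shift-exponents 1≤n 1 ((m ^ ↧ₙ q) ^ ↧ₙ u) (pos u * ↧ₙ q) (neg u * ↧ₙ q) (pos q * ↧ₙ u) 0 exponents
        (subst₂ (λ x y → x * n ^ (pos u * ↧ₙ q) ≤ y * n ^ (neg u * ↧ₙ q)) (^-zeroˡ (↧ₙ q)) (^-swap m (↧ₙ u) (↧ₙ q))
          (raise-≤ (↧ₙ q) {n} {1} {m ^ ↧ₙ u} {pos u} {neg u} (≤-trans (≤-reflexive (*-identityˡ _)) (<⇒≤ h)))))))
  where
  exponents : neg u * ↧ₙ q + pos q * ↧ₙ u ≤ pos u * ↧ₙ q
  exponents = begin
    neg u * ↧ₙ q + pos q * ↧ₙ u   ≡⟨ +-comm (neg u * ↧ₙ q) _ ⟩
    pos q * ↧ₙ u + neg u * ↧ₙ q   ≤⟨ <⇒exponents (disjoint c lower upper) ⟩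
    pos u * ↧ₙ q + neg q * ↧ₙ u   ≡⟨ cong (λ x → pos u * ↧ₙ q + x * ↧ₙ u) neg≡0 ⟩
    pos u * ↧ₙ q + 0              ≡⟨ +-identityʳ _ ⟩
    pos u * ↧ₙ q                  ∎
    where open ≤-Reasoning

power-above : ∀ {c n m C u} → 1 ≤ n → Upper c u → m <[ C · n ^ c ] → m ^ ↧ₙ u ≤ C ^ ↧ₙ u * n ^ pos u
power-above {c} {n} {m} {C} {u} 1≤n upper (q , lower , h) =
  ≤-trans (≤-reflexive (sym (*-identityʳ _)))
    (root-≤ (↧ₙ q) {n} {m ^ ↧ₙ u} {C ^ ↧ₙ u} {0} {pos u}
      (shift-exponents 1≤n ((m ^ ↧ₙ u) ^ ↧ₙ q) ((C ^ ↧ₙ u) ^ ↧ₙ q) (neg q * ↧ₙ u) (pos q * ↧ₙ u) 0 (pos u * ↧ₙ q) exponents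
        (subst₂ (λ x y → x * n ^ (neg q * ↧ₙ u) ≤ y * n ^ (pos q * ↧ₙ u)) (^-swap m (↧ₙ q) (↧ₙ u)) (^-swap C (↧ₙ q) (↧ₙ u))
          (raise-≤ (↧ₙ u) {n} {m ^ ↧ₙ q} {C ^ ↧ₙ q} {neg q} {pos q} (<⇒≤ h)))))
  where
  exponents : pos q * ↧ₙ u + 0 ≤ pos u * ↧ₙ q + neg q * ↧ₙ u
  exponents = ≤-trans (+-monoʳ-≤ (pos q * ↧ₙ u) z≤n) (<⇒exponents (disjoint c lower upper))

-- The exponent J = (1 + U) · ↧ₙ e satisfies U / J < 1 / ↧ₙ e ≤ e.
≤-power : ∀ {x n t C U e} → 1 ≤ n → 1 ≤ C → Lower x e → 1 ≤ pos e → neg e ≡ 0 →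
          t ^ (suc U * ↧ₙ e) ≤ C * n ^ U → t ≤[ C · n ^ x ]
≤-power {x} {n} {t} {C} {U} {e} 1≤n 1≤C lower 1≤e neg≡0 h q upper =
  root-≤ J {n} {t ^ ↧ₙ q} {C ^ ↧ₙ q} {neg q} {pos q} (≤-trans
    (shift-exponents 1≤n ((t ^ ↧ₙ q) ^ J) (C ^ ↧ₙ q) 0 (U * ↧ₙ q) (neg q * J) (pos q * J) exponents
      (≤-trans (≤-reflexive (trans (*-identityʳ _) (^-swap t (↧ₙ q) J)))
        (subst₂ _≤_ (*-identityʳ _) refl
          (raise-≤ (↧ₙ q) {n} {t ^ J} {C} {0} {U} (≤-trans (≤-reflexive (*-identityʳ _)) h)))))
    (*-monoˡ-≤ (n ^ (pos q * J)) (subst (_≤ (C ^ ↧ₙ q) ^ J) (^-identityʳ (C ^ ↧ₙ q))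
      (^-monoʳ-≤ (C ^ ↧ₙ q) {{m^n≢0 C (↧ₙ q) {{>-nonZero 1≤C}}}} {1} {J} (s≤s z≤n)))))
  where
  J = suc U * ↧ₙ e
  exponents : U * ↧ₙ q + neg q * J ≤ pos q * J + 0
  exponents = begin
    U * ↧ₙ q + neg q * J                           ≤⟨ +-monoˡ-≤ (neg q * J) (*-monoˡ-≤ (↧ₙ q) (n≤1+n U)) ⟩
    suc U * ↧ₙ q + neg q * J                       ≡⟨ collect (suc U) (↧ₙ q) (neg q) (↧ₙ e) ⟩
    suc U * (1 * ↧ₙ q + neg q * ↧ₙ e)              ≤⟨ *-monoʳ-≤ (suc U) (+-monoˡ-≤ (neg q * ↧ₙ e) (*-monoˡ-≤ (↧ₙ q) 1≤e)) ⟩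
    suc U * (pos e * ↧ₙ q + neg q * ↧ₙ e)          ≤⟨ *-monoʳ-≤ (suc U) (<⇒exponents (disjoint x lower upper)) ⟩
    suc U * (pos q * ↧ₙ e + neg e * ↧ₙ q)          ≡⟨ cong (λ z → suc U * (pos q * ↧ₙ e + z * ↧ₙ q)) neg≡0 ⟩
    suc U * (pos q * ↧ₙ e + 0)                     ≡⟨ expand (suc U) (pos q) (↧ₙ e) ⟩
    pos q * J + 0                                  ∎
    where
    open ≤-Reasoning
    collect : ∀ u y m e → u * y + m * (u * e) ≡ u * (1 * y + m * e)
    collect = solve-∀
    expand : ∀ u p e → u * (p * e + 0) ≡ p * (u * e) + 0
    expand = solve-∀

-- Both directions of the rounding are used: n ≤ 2^(d + 1) replaces the 2^d of the gap by n, and 2^d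
-- < 2 · n^p, for some p below `c`, turns the right side into a power of n. Together L is at most a
-- constant times n^(p - 1/R).
Gap⇒≤-power : ∀ {c n d r C L} → 1 ≤ n → 1 ≤ C → n ≤ 2 ^ suc d → 2 ^ d <[ 2 · n ^ c ] →
              Gap (suc r) C d L → L ≤[ 2 * C * 2 ^ suc r · n ^ c -ʳ fromℚ (1/suc r) ]
Gap⇒≤-power {c} {n} {d} {r} {C} {L} 1≤n 1≤C n≤ (p , lower , 2^d<) gap q (a , b , upper , b< , a<) =
  root-≤ (R * P) {n} {L ^ Y} {E ^ Y} {neg q} {pos q} (begin
    (L ^ Y) ^ (R * P) * n ^ (neg q * (R * P))
      ≤⟨ shift-exponents 1≤n ((L ^ Y) ^ (R * P)) ((E ^ P) ^ Y) ((P + neg p * R) * Y) (pos p * R * Y) (neg q * (R * P)) (pos q * (R * P)) exponents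
           (subst (λ z → z * n ^ ((P + neg p * R) * Y) ≤ (E ^ P) ^ Y * n ^ (pos p * R * Y)) L-power
             (raise-≤ Y {n} {L ^ (R * P)} {E ^ P} {P + neg p * R} {pos p * R} main)) ⟩
    (E ^ P) ^ Y * n ^ (pos q * (R * P))
      ≤⟨ *-monoˡ-≤ (n ^ (pos q * (R * P))) (≤-trans (≤-reflexive (^-swap E P Y)) (^-monoʳ-≤ (E ^ Y) {{m^n≢0 E Y {{>-nonZero 1≤E}}}} (m≤n*m P R))) ⟩
    (E ^ Y) ^ (R * P) * n ^ (pos q * (R * P)) ∎)
  where
  open ≤-Reasoning
  R = suc r
  P = ↧ₙ p
  Y = ↧ₙ q
  E = 2 * C * 2 ^ R
  1≤E : 1 ≤ E
  1≤E = *-mono-≤ (*-mono-≤ (s≤s (z≤n {1})) 1≤C) (m^n>0 2 R)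
  L-power : (L ^ (R * P)) ^ Y ≡ (L ^ Y) ^ (R * P)
  L-power = ^-swap L (R * P) Y
  exponents : pos p * R * Y + neg q * (R * P) ≤ pos q * (R * P) + (P + neg p * R) * Y
  exponents = begin
    pos p * R * Y + neg q * (R * P)                          ≡⟨ cong (_+ neg q * (R * P)) (reorder (pos p) R Y) ⟩
    -- An upper bound `q` of c - 1/R comes with c < a < q + b and b < 1/R; with p < c this gives p <
    -- q + 1/R.
    pos p * (Y * R) + neg q * (R * P)                        ≤⟨ <+1/suc⇒exponents {p} {q} r (ℚP.<-trans (disjoint c lower upper) (ℚP.<-trans a< (ℚP.+-monoʳ-< q b<))) ⟩
    pos q * (R * P) + Y * P + neg p * (Y * R)                ≡⟨ collect (pos q * (R * P)) Y P (neg p) R ⟩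
    pos q * (R * P) + (P + neg p * R) * Y                    ∎
    where
    reorder : ∀ x y z → x * y * z ≡ x * (z * y)
    reorder = solve-∀
    collect : ∀ x y p m r → x + y * p + m * (y * r) ≡ x + (p + m * r) * y
    collect = solve-∀
  L^Rn≤ : L ^ R * n ≤ 2 * C * 2 ^ (d * R)
  L^Rn≤ = begin
    L ^ R * n               ≤⟨ *-monoʳ-≤ (L ^ R) n≤ ⟩
    L ^ R * (2 * 2 ^ d)     ≡⟨ swap (L ^ R) 2 (2 ^ d) ⟩
    2 * (L ^ R * 2 ^ d)     ≤⟨ *-monoʳ-≤ 2 gap ⟩
    2 * (C * 2 ^ (d * R))   ≡⟨ sym (*-assoc 2 C _) ⟩
    2 * C * 2 ^ (d * R)     ∎
    where
    swap : ∀ a b c → a * (b * c) ≡ b * (a * c)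
    swap = solve-∀
  main : L ^ (R * P) * n ^ (P + neg p * R) ≤ E ^ P * n ^ (pos p * R)
  main = begin
    L ^ (R * P) * n ^ (P + neg p * R)                         ≡⟨ cong₂ _*_ (sym (^-*-assoc L R P)) (^-distribˡ-+-* n P (neg p * R)) ⟩
    (L ^ R) ^ P * (n ^ P * n ^ (neg p * R))                   ≡⟨ sym (*-assoc ((L ^ R) ^ P) _ _) ⟩
    (L ^ R) ^ P * n ^ P * n ^ (neg p * R)                     ≡⟨ cong (_* n ^ (neg p * R)) (sym (^-distribʳ-* (L ^ R) n P)) ⟩
    (L ^ R * n) ^ P * n ^ (neg p * R)                         ≤⟨ *-monoˡ-≤ (n ^ (neg p * R)) (^-monoˡ-≤ P L^Rn≤) ⟩
    (2 * C * 2 ^ (d * R)) ^ P * n ^ (neg p * R)               ≡⟨ cong (_* n ^ (neg p * R)) (^-distribʳ-* (2 * C) _ P) ⟩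
    (2 * C) ^ P * (2 ^ (d * R)) ^ P * n ^ (neg p * R)         ≡⟨ *-assoc ((2 * C) ^ P) _ _ ⟩
    (2 * C) ^ P * ((2 ^ (d * R)) ^ P * n ^ (neg p * R))       ≡⟨ cong (λ z → (2 * C) ^ P * (z * n ^ (neg p * R))) (trans (cong (_^ P) (sym (^-*-assoc 2 d R))) (^-swap (2 ^ d) R P)) ⟩
    (2 * C) ^ P * (((2 ^ d) ^ P) ^ R * n ^ (neg p * R))       ≤⟨ *-monoʳ-≤ ((2 * C) ^ P) (raise-≤ R {n} {(2 ^ d) ^ P} {2 ^ P} {neg p} {pos p} (<⇒≤ 2^d<)) ⟩
    (2 * C) ^ P * ((2 ^ P) ^ R * n ^ (pos p * R))             ≡⟨ sym (*-assoc ((2 * C) ^ P) _ _) ⟩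
    (2 * C) ^ P * (2 ^ P) ^ R * n ^ (pos p * R)               ≡⟨ cong (_* n ^ (pos p * R)) (trans (cong ((2 * C) ^ P *_) (^-swap 2 P R)) (sym (^-distribʳ-* (2 * C) (2 ^ R) P))) ⟩
    E ^ P * n ^ (pos p * R)                                   ∎

positive⇒parts : ∀ {q} → 0ℚ ℚ.< q → 1 ≤ pos q × neg q ≡ 0
positive⇒parts {mkℚ (ℤ.+ zero)    _ _} h with ℚP.drop-*<* h
... | ℤ.+<+ ()
positive⇒parts {mkℚ (ℤ.+ suc a) _ _} h = s≤s z≤n , refl
positive⇒parts {mkℚ ℤ.-[1+ a ]  _ _} h with ℚP.drop-*<* h
... | ()

above1⇒parts : ∀ {q} → 1ℚ ℚ.< q → ↧ₙ q < pos q × neg q ≡ 0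
above1⇒parts {q@(mkℚ (ℤ.+ a)    _ _)} h =
  subst₂ _<_ (*-identityˡ (↧ₙ q)) (*-identityʳ a)
    (ℤP.drop‿+<+ (subst₂ ℤ._<_ (sym (ℤP.pos-* 1 (↧ₙ q))) (sym (ℤP.pos-* a 1)) (ℚP.drop-*<* h))) , refl
above1⇒parts {mkℚ ℤ.-[1+ a ] _ _} h with ℚP.drop-*<* h
... | ()

-- Assembly of the index for real exponents

module Construction (c ε : ℝ)
  {c₁ c₂ e : ℚ} (1<c₁ : 1ℚ ℚ.< c₁) (c₁<c : Lower c c₁) (c<c₂ : Upper c c₂)
  (0<e : 0ℚ ℚ.< e) (e<ε : Lower ε e)
  {J j : ℕ} (J≢0 : NonZero J) (J≡ : J ≡ suc (pos c₂) * ↧ₙ e)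
  -- The first inequality lets `near-gap` absorb the power of N into the space, the second lets
  -- `time-bound` do so for the time.
  (4c₁≤j : 4 * pos c₁ ≤ j) (2J≤j : J * 2 ≤ j) where

  U : ℕ
  U = pos c₂

  private
    instance
      J≢0′ : NonZero J
      J≢0′ = J≢0

  j≢0 : NonZero j
  j≢0 = >-nonZero (≤-trans (>-nonZero⁻¹ J) (≤-trans (m≤m*n J 2) 2J≤j))

  open Parameters j j≢0
  open Space (pos c₁) (↧ₙ c₁) (proj₁ (above1⇒parts 1<c₁)) 4c₁≤j

  -- The exponent 7 + 2d + ⌈log₂ n⌉ of `size+d<` with `d` replaced by its bound ↧ₙ c₂ + U · ⌈log₂
  -- n⌉, because the word size may depend on n alone.
  wordLength : ℕ → ℕ
  wordLength n = 7 + 2 * ↧ₙ c₂ + (2 * U + 1) * ⌈log₂ n ⌉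

  wordLength-Θ : IsΘlog wordLength
  wordLength-Θ = A , 2 , λ n 2≤n →
    let l = ⌈log₂ n ⌉
        1≤l = ⌈log₂⌉-mono-≤ {2} {n} 2≤n
    in ≤-trans (≤-trans (m≤n*m l (2 * U + 1) {{2U+1≢0}}) (m≤n+m _ (7 + 2 * ↧ₙ c₂))) (m≤n*m (wordLength n) A) ,
       ≤-trans (+-monoˡ-≤ ((2 * U + 1) * l) (m≤m*n′ (7 + 2 * ↧ₙ c₂) 1≤l))
               (≤-reflexive (sym (*-distribʳ-+ l (7 + 2 * ↧ₙ c₂) (2 * U + 1))))
    where
    A = 7 + 2 * ↧ₙ c₂ + (2 * U + 1)
    2U+1≢0 : NonZero (2 * U + 1)
    2U+1≢0 = >-nonZero (m≤n+m 1 (2 * U))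

  structureWords : ∀ {n d} → Vec (Vec Bool d) n → List (Word (wordLength n))
  structureWords {n} S = List.map (trunc (wordLength n)) (Index.structure S)

  module _ {n d} (1≤n : 1 ≤ n) (rounds : d RoundsLog[ c , n ]) where
    private
      instance
        n≢0 : NonZero n
        n≢0 = >-nonZero 1≤n

    dimension-lower : n ^ pos c₁ ≤ 2 ^ (suc d * ↧ₙ c₁)
    dimension-lower = ≤-trans (power-below {c} {n} {2 ^ suc d} {c₁} 1≤n c₁<c (proj₂ (above1⇒parts 1<c₁)) (proj₂ rounds))
                              (≤-reflexive (^-*-assoc 2 (suc d) (↧ₙ c₁)))

    dimension-upper : (2 ^ d) ^ ↧ₙ c₂ ≤ 2 ^ ↧ₙ c₂ * n ^ U
    dimension-upper = power-above {c} {n} {2 ^ d} {2} {c₂} 1≤n c<c₂ (proj₁ rounds)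

    n≤2^[1+d] : n ≤ 2 ^ suc d
    n≤2^[1+d] = ^-cancelˡ-≤ (pos c₁) {{c₁≢0}} (≤-trans dimension-lower
      (≤-trans (^-monoʳ-≤ 2 (*-monoʳ-≤ (suc d) (<⇒≤ ↧<pos))) (≤-reflexive (sym (^-*-assoc 2 (suc d) (pos c₁))))))
      where
      ↧<pos = proj₁ (above1⇒parts 1<c₁)
      c₁≢0 : NonZero (pos c₁)
      c₁≢0 = >-nonZero (≤-<-trans z≤n ↧<pos)

    d≤ : d ≤ ↧ₙ c₂ + U * ⌈log₂ n ⌉
    d≤ = ≤-trans (m≤m*n d (↧ₙ c₂)) (^-cancelʳ-≤ 2 (s≤s (s≤s z≤n)) (begin
      2 ^ (d * ↧ₙ c₂)                            ≡⟨ sym (^-*-assoc 2 d (↧ₙ c₂)) ⟩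
      (2 ^ d) ^ ↧ₙ c₂                            ≤⟨ dimension-upper ⟩
      2 ^ ↧ₙ c₂ * n ^ U                          ≤⟨ *-monoʳ-≤ (2 ^ ↧ₙ c₂) (^-monoˡ-≤ U (n≤2^⌈log₂n⌉ n)) ⟩
      2 ^ ↧ₙ c₂ * (2 ^ ⌈log₂ n ⌉) ^ U            ≡⟨ cong (2 ^ ↧ₙ c₂ *_) (trans (^-*-assoc 2 ⌈log₂ n ⌉ U) (cong (2 ^_) (*-comm ⌈log₂ n ⌉ U))) ⟩
      2 ^ ↧ₙ c₂ * 2 ^ (U * ⌈log₂ n ⌉)            ≡⟨ sym (^-distribˡ-+-* 2 (↧ₙ c₂) (U * ⌈log₂ n ⌉)) ⟩
      2 ^ (↧ₙ c₂ + U * ⌈log₂ n ⌉)                ∎))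
      where open ≤-Reasoning

    module _ (S : Vec (Vec Bool d) n) where
      open Index S

      fits : size + d < 2 ^ wordLength n
      fits = ≤-trans (size+d< {⌈log₂ n ⌉} 1≤n (n≤2^⌈log₂n⌉ n)) (^-monoʳ-≤ 2 (begin
        7 + 2 * d + l                                ≤⟨ +-monoˡ-≤ l (+-monoʳ-≤ 7 (*-monoʳ-≤ 2 d≤)) ⟩
        7 + 2 * (↧ₙ c₂ + U * l) + l                  ≡⟨ expand (↧ₙ c₂) U l ⟩
        wordLength n                                 ∎))
        where
        open ≤-Reasoning
        l = ⌈log₂ n ⌉
        expand : ∀ b U l → 7 + 2 * (b + U * l) + l ≡ 7 + 2 * b + (2 * U + 1) * l
        expand = solve-∀

      answered : ∀ v {t} → t ≡ time d → ∃[ b ]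
        run walker t (initial (wordLength n) (structureWords S) v) ≡ just b ×
        (b ≡ true ⇔ HasOrthogonal S v)
      answered v t≡ =
        let b , runs , iff = answer-structure (wordLength n) stored (additions d) v fits t≡
        in b , runs , found⇔HasOrthogonal (2threshold≤ d) v ⇔-∘ iff

  halts : ∀ {n d} → 1 ≤ n → d RoundsLog[ c , n ] → (S : Vec (Vec Bool d) n) (v : Vec Bool d) →
          ∀ {t} → t ≡ time d →
          ∃[ t ] ∃[ b ] run walker t (initial (wordLength n) (structureWords S) v) ≡ just b ×
                        (b ≡ true ⇔ HasOrthogonal S v)
  halts {n} {d} 1≤n rounds S v {t} t≡ = t , answered {n} {d} 1≤n rounds S v t≡

  index : OVIndex c
  index = record
    { wordSize   = wordLength
    ; wordSize-Θ = wordLength-Θ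
    ; preprocess = structureWords
    ; query      = walker
    ; correct    = λ {n} {d} 1≤n rounds S _ v → halts {n} {d} 1≤n rounds S v refl
    }

  γ : ℝ
  γ = fromℚ (1/suc (pred R))

  0<γ : 0ʳ <ʳ γ
  0<γ = ℚP.<-dense (ℚP.positive⁻¹ (1/suc (pred R)))

  Cₜ : ℕ
  Cₜ = (15 ^ (J * 2) * (J * 2) ^ (J * 2)) ^ ↧ₙ c₂ * 2 ^ ↧ₙ c₂

  queryTime : QueryTimeO index ε
  queryTime = Cₜ , 0 , λ {n} {d} _ 1≤n rounds S _ v → timed {n} {d} 1≤n rounds S v refl
    where
    open ≤-Reasoning
    c′ = 15 ^ (J * 2) * (J * 2) ^ (J * 2)
    instance
      2J≢0 : NonZero (J * 2)
      2J≢0 = m*n≢0 J 2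
      c′≢0 : NonZero c′
      c′≢0 = m*n≢0 (15 ^ (J * 2)) ((J * 2) ^ (J * 2)) {{m^n≢0 15 (J * 2)}} {{m^n≢0 (J * 2) (J * 2)}}
    1≤Cₜ : 1 ≤ Cₜ
    1≤Cₜ = *-mono-≤ (m^n>0 c′ (↧ₙ c₂)) (m^n>0 2 (↧ₙ c₂))
    bound : ∀ {n d} → 1 ≤ n → d RoundsLog[ c , n ] → time d ^ J ≤ Cₜ * n ^ U
    bound {n} {d} 1≤n rounds = begin
      time d ^ J                             ≡⟨ sym (^-identityʳ _) ⟩
      -- `dimension-upper` bounds only the power (2^d)^(↧ₙ c₂), so the right side is raised to it;
      -- on the left this only increases a number that is at least 1.
      (time d ^ J) ^ 1                       ≤⟨ ^-monoʳ-≤ (time d ^ J) {{m^n≢0 (time d) J}} {1} {↧ₙ c₂} (s≤s z≤n) ⟩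
      (time d ^ J) ^ ↧ₙ c₂                   ≤⟨ ^-monoˡ-≤ (↧ₙ c₂) (time-bound J d 2J≤j) ⟩
      (c′ * 2 ^ d) ^ ↧ₙ c₂                   ≡⟨ ^-distribʳ-* c′ (2 ^ d) (↧ₙ c₂) ⟩
      c′ ^ ↧ₙ c₂ * (2 ^ d) ^ ↧ₙ c₂           ≤⟨ *-monoʳ-≤ (c′ ^ ↧ₙ c₂) (dimension-upper {n} {d} 1≤n rounds) ⟩
      c′ ^ ↧ₙ c₂ * (2 ^ ↧ₙ c₂ * n ^ U)       ≡⟨ sym (*-assoc (c′ ^ ↧ₙ c₂) _ _) ⟩
      Cₜ * n ^ U                             ∎
    timed : ∀ {n d} → 1 ≤ n → d RoundsLog[ c , n ] → (S : Vec (Vec Bool d) n) (v : Vec Bool d) →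
            ∀ {t} → t ≡ time d →
            ∃[ t ] ∃[ b ] run walker t (initial (wordLength n) (structureWords S) v) ≡ just b × t ≤[ Cₜ · n ^ ε ]
    timed {n} {d} 1≤n rounds S v {t} t≡ =
      let b , runs , _ = answered {n} {d} 1≤n rounds S v t≡ in
      t , b , runs ,
      ≤-power {ε} {t = t} {Cₜ} {U} {e} 1≤n 1≤Cₜ e<ε (proj₁ (positive⇒parts 0<e)) (proj₂ (positive⇒parts 0<e))
        (subst₂ (λ t z → t ^ z ≤ Cₜ * n ^ U) (sym t≡) J≡ (bound {n} {d} 1≤n rounds))

  space : SpaceO index (c -ʳ γ)
  -- `suc C` makes the constant visibly positive, and `suc (pred R)` has the form of the denominator
  -- in `γ`.
  space = 2 * suc C * 2 ^ suc (pred R) , 0 , λ {n} {d} _ 1≤n rounds S _ →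
    subst (_≤[ 2 * suc C * 2 ^ suc (pred R) · n ^ c -ʳ γ ])
      (sym (trans (length-map (trunc (wordLength n)) (Index.structure S)) (length-structure (Index.stored S) (additions d))))
      (Gap⇒≤-power {c} {n} {d} {pred R} {suc C} {Index.size S} 1≤n (s≤s z≤n) (n≤2^[1+d] {n} {d} 1≤n rounds) (proj₁ rounds)
        (subst (λ R → Gap R (suc C) d (Index.size S)) (sym (suc-pred R {{R≢0}}))
          (≤-trans (size-gap S 1≤n (dimension-lower {n} {d} 1≤n rounds)) (*-monoˡ-≤ (2 ^ (d * R)) (n≤1+n C)))))

theorem6 : (c : ℝ) → 1ʳ <ʳ c → (ε : ℝ) → 0ʳ <ʳ ε →
    Σ[ γ ∈ ℝ ] (0ʳ <ʳ γ × (Σ[ I ∈ OVIndex c ] (QueryTimeO I ε × SpaceO I (c -ʳ γ))))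
theorem6 c (c₁ , 1<c₁ , c₁<c) ε (e , 0<e , e<ε) =
  -- Any precision would do: locating `c` serves only to obtain some rational upper bound `c₂`.
  let _ , c₂ , _ , c<c₂ , _ = located c (ℚP.positive⁻¹ 1ℚ)
      J = suc (pos c₂) * ↧ₙ e
      open Construction c ε 1<c₁ c₁<c c<c₂ 0<e e<ε {J} {4 * pos c₁ + J * 2} (m*n≢0 (suc (pos c₂)) (↧ₙ e)) refl
             (m≤m+n (4 * pos c₁) (J * 2)) (m≤n+m (J * 2) (4 * pos c₁))
  in γ , 0<γ , index , queryTime , space
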